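{- For $1\le i\le r$, $C_{i,r}(a)=G_{i,r-i+2}(a)$ as polynomials in $a$.
   Context: Bernoulli polynomials $B_n(a)$: $\sum_{n\ge0}B_n(a)x^n/n!=xe^{ax}/(e^x-1)$. For $1\le i\le r$, let $S_{i,r}$ be the set of $(n_1,\dots,n_r)\in\mathbb Z_{\ge0}^r$ with $n_1+\dots+n_r=r$, $n_1+\dots+n_j<j$ ($1\le j<i$), and $n_{j+1}+\dots+n_r\le r-j$ ($i\le j<r$), and $C_{i,r}(a)=(-1)^r\sum_{(n_1,\dots,n_r)\in S_{i,r}}\prod_{j=1}^r\frac{B_{n_j}(a)}{n_j!}$. Let $L(a,t)=\sum_{n\ge1}\lambda_n(a)t^n\in\mathbb Q[a][[t]]$ be the compositional inverse (in $t$) of $e^{ -at}(e^t-1)$, equivalently the unique such series with $e^{L(a,t)}(1-te^{(a-1)L(a,t)})=1$. The generalized Gregory polynomials $G_{m,n}(a)$ are defined by \[ \sum_{m,n\ge0}G_{m,n}(a)x^my^n=\frac{yL(a,-x)^2-xL(a,-y)^2}{ -L(a,-x)+L(a,-y)}. \] -}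

module Defs where

open import Algebra.Bundles.Raw using (RawRing)
import Algebra.Definitions.RawSemiring as RawSemiringDefinitions
open import Data.Fin.Base using (Fin; toℕ)
import Data.Integer.Base as ℤ
open import Data.List.Base as List using (List; []; _∷_)
open import Data.List.Membership.Propositional using (_∈_)
open import Data.List.Membership.Propositional.Properties
  using (∈-cartesianProductWith⁺; ∈-filter⁺; ∈-filter⁻; ∈-upTo⁺)
open import Data.List.Relation.Unary.Any using (here)
open import Data.List.Relation.Unary.All using ([])
open import Data.List.Relation.Unary.AllPairs using ([]; _∷_)
open import Data.List.Relation.Unary.Unique.Propositional using (Unique)
import Data.List.Relation.Unary.Unique.Propositional.Properties as Unique
open import Data.Nat.Base as ℕ using (ℕ; zero; suc; _∸_; _≤_; _<_; s≤s; _!)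
import Data.Nat.ListAction as ListAction
open import Data.Nat.Properties as ℕ
  using (_≤?_; _<?_; allUpTo?; m≤m+n; m≤n+m; ≤-refl; ≤-reflexive; ≤-trans; _!≢0)
open import Data.Product.Base using (_×_; _,_; proj₂)
open import Data.Rational.Base as ℚ using (ℚ; 0ℚ; 1ℚ)
open import Data.Vec.Base as Vec using (Vec; []; _∷_)
open import Data.Vec.Properties using (∷-injective)
open import Function.Bundles using (_⇔_; mk⇔)
open import Level using (Level; 0ℓ)
open import Relation.Binary.PropositionalEquality.Core using (_≡_; refl)
open import Relation.Nullary.Decidable using (Dec; _×-dec_; _→-dec_)

private
  variable
    c ℓ : Level

------------------------------------------------------------------------
-- Polynomials in one variable, by their coefficients in increasing
-- degree.  Trailing zeros are allowed, so equality is coefficientwise.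

module Polynomial (R : RawRing c ℓ) where
  private module R = RawRing R

  coeff : List R.Carrier → ℕ → R.Carrier
  coeff []      _       = R.0#
  coeff (x ∷ _) zero    = x
  coeff (_ ∷ p) (suc n) = coeff p n

  scale : R.Carrier → List R.Carrier → List R.Carrier
  scale x = List.map (x R.*_)

  add : List R.Carrier → List R.Carrier → List R.Carrier
  add []      q       = q
  add (x ∷ p) []      = x ∷ p
  add (x ∷ p) (y ∷ q) = x R.+ y ∷ add p q

  mul : List R.Carrier → List R.Carrier → List R.Carrier
  mul []      q = []
  mul (x ∷ p) q = add (scale x q) (R.0# ∷ mul p q)

  rawRing : RawRing c ℓ
  rawRing = record
    { Carrier = List R.Carrier
    ; _≈_     = λ p q → ∀ n → coeff p n R.≈ coeff q n
    ; _+_     = add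
    ; _*_     = mul
    ; -_      = List.map R.-_
    ; 0#      = []
    ; 1#      = R.1# ∷ []
    }

  indeterminate : List R.Carrier
  indeterminate = R.0# ∷ R.1# ∷ []

------------------------------------------------------------------------
-- Formal power series in one variable

module PowerSeries (R : RawRing c ℓ) where
  private
    module R = RawRing R
    module RDefs = RawSemiringDefinitions R.rawSemiring

  Series : Set c
  Series = ℕ → R.Carrier

  constant : R.Carrier → Series
  constant x zero    = x
  constant x (suc _) = R.0#

  X : Series
  X 1 = R.1#
  X _ = R.0#

  rawRing : RawRing c ℓ
  rawRing = record
    { Carrier = Series
    ; _≈_     = λ f g → ∀ n → f n R.≈ g n
    ; _+_     = λ f g n → f n R.+ g n
    ; _*_     = λ f g n → RDefs.sum λ (k : Fin (suc n)) → f (toℕ k) R.* g (n ∸ toℕ k)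
    ; -_      = λ f n → R.- f n
    ; 0#      = λ _ → R.0#
    ; 1#      = constant R.1#
    }

  private
    module S = RawRing rawRing
    module SDefs = RawSemiringDefinitions S.rawSemiring

  -- The series f(-t).
  atNegative : Series → Series
  atNegative f n = (R.- R.1#) RDefs.^ n R.* f n

  -- The substitution f(g(t)), meaningful only when g has zero constant
  -- term: then g ^ k contributes nothing to the coefficient of tⁿ for
  -- k > n, which is why the sum may stop at k = n.
  infixr 9 _∘_
  _∘_ : Series → Series → Series
  (f ∘ g) n = RDefs.sum λ (k : Fin (suc n)) → f (toℕ k) R.* (g SDefs.^ toℕ k) n

  record IsCompositionalInverse (f g : Series) : Set ℓ where
    field
      f₀≈0  : f 0 R.≈ R.0#
      g₀≈0  : g 0 R.≈ R.0#
      f∘g≈X : f ∘ g S.≈ X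
      g∘f≈X : g ∘ f S.≈ X

------------------------------------------------------------------------
-- The ring ℚ[a] and power series over it

module ℚ[a] where
  open Polynomial ℚ.+-*-rawRing public
    using (coeff; rawRing) renaming (scale to infixr 7 _•_; indeterminate to a)
  open RawRing rawRing public
  open RawSemiringDefinitions rawSemiring public using (_^_; sum; product)

module ℚ[a]⟦t⟧ where
  open PowerSeries ℚ[a].rawRing public
  open RawRing rawRing public hiding (Carrier)
  open RawSemiringDefinitions rawSemiring public using (_^_)

-- ℚ[a]⟦x,y⟧ as ℚ[a]⟦y⟧⟦x⟧: the coefficient of xᵐyⁿ in F is F m n.
module ℚ[a]⟦x,y⟧ where
  private module Iterated = PowerSeries ℚ[a]⟦t⟧.rawRing
  open Iterated public using (rawRing) renaming (Series to Series₂)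
  open RawRing rawRing public hiding (Carrier)
  open RawSemiringDefinitions rawSemiring public using (_^_)

  inX : ℚ[a]⟦t⟧.Series → Series₂
  inX f m = ℚ[a]⟦t⟧.constant (f m)

  inY : ℚ[a]⟦t⟧.Series → Series₂
  inY f = Iterated.constant f

  x y : Series₂
  x = inX ℚ[a]⟦t⟧.X
  y = inY ℚ[a]⟦t⟧.X

1/_! : ℕ → ℚ
1/ n ! = ℚ._/_ (ℤ.+ 1) (n !) {{n !≢0}}

-- The series e^{ut} for u in ℚ[a].
exp : ℚ[a].Carrier → ℚ[a]⟦t⟧.Series
exp u n = (1/ n !) ℚ[a].• (u ℚ[a].^ n)

------------------------------------------------------------------------
-- Bernoulli polynomials, L(a,t) and the generalized Gregory polynomials.
-- Each is given by its defining equation, with denominators cleared.  Each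
-- equation has exactly one solution up to ≈: e^t - 1 is t times a unit,
-- e^{-at}(e^t - 1) = t + ⋯, and -L(a,-x) + L(a,-y) is x - y times a unit,
-- while the numerator of the Gregory series vanishes at x = y.

IsBernoulli : (ℕ → ℚ[a].Carrier) → Set
IsBernoulli B = (exp ℚ[a].1# + - 1#) * (λ n → (1/ n !) ℚ[a].• B n) ≈ X * exp ℚ[a].a
  where open ℚ[a]⟦t⟧

IsL : ℚ[a]⟦t⟧.Series → Set
IsL = IsCompositionalInverse (exp (ℚ[a].- ℚ[a].a) * (exp ℚ[a].1# + - 1#))
  where open ℚ[a]⟦t⟧

IsGregory : ℚ[a]⟦t⟧.Series → (ℕ → ℕ → ℚ[a].Carrier) → Set
IsGregory L G = (- L[-x] + L[-y]) * G ≈ y * L[-x] ^ 2 + - (x * L[-y] ^ 2)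
  where
  open ℚ[a]⟦x,y⟧
  L[-x] L[-y] : Series₂
  L[-x] = inX (ℚ[a]⟦t⟧.atNegative L)
  L[-y] = inY (ℚ[a]⟦t⟧.atNegative L)

------------------------------------------------------------------------
-- The index set S i r

-- n₁ + ⋯ + n_j
prefixSum : ∀ {r} → ℕ → Vec ℕ r → ℕ
prefixSum j ns = ListAction.sum (List.take j (Vec.toList ns))

-- n_{j+1} + ⋯ + n_r
suffixSum : ∀ {r} → ℕ → Vec ℕ r → ℕ
suffixSum j ns = ListAction.sum (List.drop j (Vec.toList ns))

InS : ∀ (i : ℕ) {r} → Vec ℕ r → Set
InS i {r} ns =
    Vec.sum ns ≡ r
  × (∀ {j} → j < i → 1 ≤ j → prefixSum j ns < j)
  × (∀ {j} → j < r → i ≤ j → suffixSum j ns ≤ r ∸ j)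

InS? : ∀ (i : ℕ) {r} (ns : Vec ℕ r) → Dec (InS i ns)
InS? i {r} ns =
        (Vec.sum ns ℕ.≟ r)
  ×-dec allUpTo? (λ j → (1 ≤? j) →-dec (prefixSum j ns <? j)) i
  ×-dec allUpTo? (λ j → (i ≤? j) →-dec (suffixSum j ns ≤? r ∸ j)) r

-- All k-tuples with entries at most b.
tuples : (b k : ℕ) → List (Vec ℕ k)
tuples b zero    = [] ∷ []
tuples b (suc k) = List.cartesianProductWith _∷_ (List.upTo (suc b)) (tuples b k)

-- Entries of a tuple with sum r are at most r, so nothing is lost by
-- bounding them; see ∈-S⇔InS.
S : (i r : ℕ) → List (Vec ℕ r)
S i r = List.filter (InS? i) (tuples r r)

∈-tuples : ∀ {b k} (ns : Vec ℕ k) → Vec.sum ns ≤ b → ns ∈ tuples b k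
∈-tuples []       _  = here refl
∈-tuples (n ∷ ns) ≤b = ∈-cartesianProductWith⁺ _∷_
  (∈-upTo⁺ (s≤s (≤-trans (m≤m+n n (Vec.sum ns)) ≤b)))
  (∈-tuples ns (≤-trans (m≤n+m (Vec.sum ns) n) ≤b))

∈-S⇔InS : ∀ {i r} (ns : Vec ℕ r) → ns ∈ S i r ⇔ InS i ns
∈-S⇔InS {i} {r} ns = mk⇔
  (λ ns∈S → proj₂ (∈-filter⁻ (InS? i) {xs = tuples r r} ns∈S))
  (λ { ins@(sum≡r , _) → ∈-filter⁺ (InS? i) (∈-tuples ns (≤-reflexive sum≡r)) ins })

tuples-unique : ∀ b k → Unique (tuples b k)
tuples-unique b zero    = [] ∷ []
tuples-unique b (suc k) =
  Unique.cartesianProductWith⁺ _∷_ ∷-injective (Unique.upTo⁺ (suc b)) (tuples-unique b k)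

S-unique : ∀ i r → Unique (S i r)
S-unique i r = Unique.filter⁺ (InS? i) (tuples-unique r r)

------------------------------------------------------------------------

C : (B : ℕ → ℚ[a].Carrier) (i r : ℕ) → ℚ[a].Carrier
C B i r = (- 1#) ^ r * List.foldr _+_ 0# (List.map term (S i r))
  where
  open ℚ[a]
  term : Vec ℕ r → Carrier
  term ns = product λ (j : Fin r) → (1/ Vec.lookup ns j !) • B (Vec.lookup ns j)

-- Write β(t) = Σ B_n(a)/n! tⁿ, γ = -β and M(t) = L(a,-t).  Since
-- t/β(t) = e^{-at}(e^t - 1), M is the solution of M = t γ(M).
--
-- Subtracting 1 from every entry turns a tuple of S_{i,r} into a walk from 0
-- to 0 which is negative before time i and nonnegative from then on.  As the
-- walk descends by at most 1 at a time, the part after time i is counted by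
-- powers of M; the part before it is summed by Lagrange inversion.  Hence
-- -C_{i,r} is the coefficient of x^{i-1} y^{r-i+1} in
-- Y = Σ_k M(x)^k γ_k(M(y)), where γ_k(t) = Σ_n γ_{k+n} tⁿ.  Splitting off the
-- first term of γ_k, respectively of the sum over k, gives
--   Y = γ(M(x)) + M(y) Y′ = γ(M(y)) + M(x) Y′,
-- so xy (M(x) - M(y)) Y = y M(x)² - x M(y)².  The Gregory series G satisfies
-- this equation with -G in place of xyY, and M(x) - M(y) is not a zero divisor.
module Submission where

open import Defs
open import Algebra.Bundles using (CommutativeRing)
open import Algebra.Bundles.Raw using (RawRing)
import Algebra.Definitions.RawSemiring as RawSemiringDefinitions
import Algebra.Morphism.RingMonomorphism as RingMonomorphism
open import Algebra.Morphism.Structures using (IsRingMonomorphism)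
import Algebra.Properties.CommutativeMonoid.Mult as CommutativeMonoidMult
import Algebra.Properties.Ring as RingProperties
import Algebra.Properties.Semiring.Exp as Exp
import Algebra.Properties.Semiring.Mult as Mult
import Algebra.Solver.Ring.NaturalCoefficients.Default as SemiringSolver
open import Data.Bool.Base using (Bool; true; false; T; _∧_)
open import Data.Bool.Properties using (T?; T-∧)
open import Data.Empty using (⊥-elim)
open import Data.Fin.Base using (Fin; toℕ)
import Data.Integer.Base as ℤ
import Data.Integer.Properties as ℤ
open import Data.List.Base as List using (List; []; _∷_; _++_; applyUpTo; cartesianProductWith; filter; foldr; map)
open import Data.List.Properties using (filter-≐)
open import Data.Nat.Base as ℕ using (ℕ; zero; suc; _∸_; _≤_; _<_; z≤n; s≤s; s≤s⁻¹; _≡ᵇ_; _≤ᵇ_; _!)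
import Data.Nat.ListAction as ListAction
import Data.Nat.Properties as ℕ
open import Data.Nat.Solver using (module +-*-Solver)
open import Data.Product.Base using (_×_; _,_)
open import Data.Rational.Base as ℚ using (toℚᵘ)
import Data.Rational.Properties as ℚ
import Data.Rational.Unnormalised.Base as ℚᵘ
import Data.Rational.Unnormalised.Properties as ℚᵘ
open import Data.Unit.Base using (tt)
open import Data.Vec.Base as Vec using (Vec; []; _∷_)
open import Function.Bundles using (module Equivalence)
open import Relation.Binary.PropositionalEquality.Core as ≡ using (_≡_)
import Relation.Binary.Reasoning.Setoid as SetoidReasoning
open import Relation.Nullary.Negation using (contradiction)

-- The ring of formal power series

module SeriesRing {c ℓ} (R : CommutativeRing c ℓ) where
  open CommutativeRing R
  open SemiringSolver commutativeSemiring using (solve; _:+_; _:*_; con; _:=_)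
  open SetoidReasoning setoid
  open PowerSeries rawRing public using (Series; constant; X)
  private
    module S = RawRing (PowerSeries.rawRing rawRing)

  tail : Series → Series
  tail f n = f (suc n)

  scale : Carrier → Series → Series
  scale x f n = x * f n

  -- A coefficient of a product sees the factors only up to its own degree. Series can therefore be
  -- replaced by truncations, whose length depends on the degree.
  *-cong-upTo : ∀ {f f′ g g′ : Series} n → (∀ {k} → k ≤ n → f k ≈ f′ k) → (∀ {k} → k ≤ n → g k ≈ g′ k) →
                (f S.* g) n ≈ (f′ S.* g′) n
  *-cong-upTo zero    f≈ g≈ = +-congʳ (*-cong (f≈ z≤n) (g≈ z≤n))
  *-cong-upTo {f} {f′} {g} {g′} (suc n) f≈ g≈ = +-cong (*-cong (f≈ z≤n) (g≈ ℕ.≤-refl))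
    (*-cong-upTo {tail f} {tail f′} {g} {g′} n (λ k≤n → f≈ (s≤s k≤n)) (λ k≤n → g≈ (ℕ.m≤n⇒m≤1+n k≤n)))

  zeroˡ-upTo : ∀ {f g : Series} n → (∀ {k} → k ≤ n → f k ≈ 0#) → (f S.* g) n ≈ 0#
  zeroˡ-upTo {f} {g} zero    f≈0 = trans (+-identityʳ _) (trans (*-congʳ (f≈0 z≤n)) (zeroˡ _))
  zeroˡ-upTo {f} {g} (suc n) f≈0 = trans
    (+-cong (trans (*-congʳ (f≈0 z≤n)) (zeroˡ _)) (zeroˡ-upTo {tail f} {g} n (λ k≤n → f≈0 (s≤s k≤n))))
    (+-identityˡ _)

  ⊛-cong : ∀ {f f′ g g′} → f S.≈ f′ → g S.≈ g′ → f S.* g S.≈ f′ S.* g′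
  ⊛-cong {f} {f′} {g} {g′} f≈ g≈ n = *-cong-upTo {f} {f′} {g} {g′} n (λ {k} _ → f≈ k) (λ {k} _ → g≈ k)

  -- The product unfolds by definition at the head of the first factor; commutativity needs this
  -- expansion at the other end.
  *-tailʳ : ∀ f g n → (f S.* g) (suc n) ≈ (f S.* tail g) n + f (suc n) * g 0
  *-tailʳ f g zero = solve 2 (λ a b → a :+ (b :+ con 0) := (a :+ con 0) :+ b) refl (f 0 * g 1) (f 1 * g 0)
  *-tailʳ f g (suc n) = trans (+-congˡ (*-tailʳ (tail f) g n)) (sym (+-assoc _ _ _))

  ⊛-comm : ∀ f g → f S.* g S.≈ g S.* f
  ⊛-comm f g zero    = +-congʳ (*-comm _ _)
  ⊛-comm f g (suc n) = begin
    f 0 * g (suc n) + (tail f S.* g) n  ≈⟨ +-cong (*-comm _ _) (⊛-comm (tail f) g n) ⟩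
    g (suc n) * f 0 + (g S.* tail f) n  ≈⟨ +-comm _ _ ⟩
    (g S.* tail f) n + g (suc n) * f 0  ≈⟨ *-tailʳ g f n ⟨
    (g S.* f) (suc n)                   ∎

  ⊛-distribʳ : ∀ h f g → (f S.+ g) S.* h S.≈ f S.* h S.+ g S.* h
  ⊛-distribʳ h f g zero    = solve 3 (λ x y z → (y :+ z) :* x :+ con 0 := (y :* x :+ con 0) :+ (z :* x :+ con 0)) refl
    (h 0) (f 0) (g 0)
  ⊛-distribʳ h f g (suc n) = trans (+-cong (distribʳ _ _ _) (⊛-distribʳ h (tail f) (tail g) n))
    (solve 4 (λ x y u v → (x :+ y) :+ (u :+ v) := (x :+ u) :+ (y :+ v)) refl _ _ _ _)

  scale-* : ∀ x f g → scale x f S.* g S.≈ scale x (f S.* g)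
  scale-* x f g zero    = solve 3 (λ x y z → x :* y :* z :+ con 0 := x :* (y :* z :+ con 0)) refl x (f 0) (g 0)
  scale-* x f g (suc n) = trans (+-cong (*-assoc _ _ _) (scale-* x (tail f) g n)) (sym (distribˡ _ _ _))

  ⊛-assoc : ∀ f g h → (f S.* g) S.* h S.≈ f S.* (g S.* h)
  ⊛-assoc f g h zero = solve 3
    (λ x y z → (x :* y :+ con 0) :* z :+ con 0 := x :* (y :* z :+ con 0) :+ con 0) refl (f 0) (g 0) (h 0)
  ⊛-assoc f g h (suc n) = begin
    (f S.* g) 0 * h (suc n) + (tail (f S.* g) S.* h) n
      ≈⟨ +-cong (*-congʳ (+-identityʳ _)) (⊛-distribʳ h (scale (f 0) (tail g)) (tail f S.* g) n) ⟩
    (f 0 * g 0) * h (suc n) + ((scale (f 0) (tail g) S.* h) n + ((tail f S.* g) S.* h) n)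
      ≈⟨ +-congˡ (+-cong (scale-* (f 0) (tail g) h n) (⊛-assoc (tail f) g h n)) ⟩
    (f 0 * g 0) * h (suc n) + (f 0 * (tail g S.* h) n + (tail f S.* (g S.* h)) n)
      ≈⟨ solve 5 (λ x y z u v → x :* y :* z :+ (x :* u :+ v) := x :* (y :* z :+ u) :+ v) refl
           (f 0) (g 0) (h (suc n)) ((tail g S.* h) n) ((tail f S.* (g S.* h)) n) ⟩
    f 0 * (g S.* h) (suc n) + (tail f S.* (g S.* h)) n  ∎

  constant-* : ∀ x f → constant x S.* f S.≈ scale x f
  constant-* x f zero    = +-identityʳ _
  constant-* x f (suc n) = trans (+-congˡ (zeroˡ-upTo {S.0#} {f} n (λ _ → refl))) (+-identityʳ _)

  ⊛-identityˡ : ∀ f → S.1# S.* f S.≈ f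
  ⊛-identityˡ f n = trans (constant-* 1# f n) (*-identityˡ _)

  seriesRing : CommutativeRing c ℓ
  seriesRing = record
    { _≈_ = S._≈_ ; _+_ = S._+_ ; _*_ = S._*_ ; -_ = S.-_ ; 0# = S.0# ; 1# = S.1#
    ; isCommutativeRing = record
      { isRing = record
        { +-isAbelianGroup = record
          { isGroup = record
            { isMonoid = record
              { isSemigroup = record
                { isMagma = record
                  { isEquivalence = record
                    { refl = λ _ → refl ; sym = λ p n → sym (p n) ; trans = λ p q n → trans (p n) (q n) }
                  ; ∙-cong = λ p q n → +-cong (p n) (q n)
                  }
                ; assoc = λ f g h n → +-assoc (f n) (g n) (h n)
                }
              ; identity = (λ f n → +-identityˡ (f n)) , (λ f n → +-identityʳ (f n))
              }
            ; inverse = (λ f n → -‿inverseˡ (f n)) , (λ f n → -‿inverseʳ (f n))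
            ; ⁻¹-cong = λ p n → -‿cong (p n)
            }
          ; comm = λ f g n → +-comm (f n) (g n)
          }
        ; *-cong = λ {f} {f′} {g} {g′} → ⊛-cong {f} {f′} {g} {g′}
        ; *-assoc = ⊛-assoc
        ; *-identity = ⊛-identityˡ , λ f n → trans (⊛-comm f S.1# n) (⊛-identityˡ f n)
        ; distrib = (λ h f g n → trans (⊛-comm h (f S.+ g) n) (trans (⊛-distribʳ h f g n)
                                   (+-cong (⊛-comm f h n) (⊛-comm g h n))))
                  , ⊛-distribʳ
        }
      ; *-comm = ⊛-comm
      }
    }

-- Finite sums over initial segments

module Sums {c ℓ} (R : CommutativeRing c ℓ) where
  open CommutativeRing R
  open RawSemiringDefinitions (RawRing.rawSemiring rawRing) using (sum)
  open SemiringSolver commutativeSemiring using (solve; _:+_; _:=_)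

  ∑ : ℕ → (ℕ → Carrier) → Carrier
  ∑ n f = sum {n} (λ k → f (toℕ k))

  ∑-cong : ∀ n f g → (∀ {k} → k < n → f k ≈ g k) → ∑ n f ≈ ∑ n g
  ∑-cong zero    f g f≈g = refl
  ∑-cong (suc n) f g f≈g = +-cong (f≈g (s≤s z≤n)) (∑-cong n (λ k → f (suc k)) (λ k → g (suc k)) (λ k<n → f≈g (s≤s k<n)))

  ∑-zero : ∀ n f → (∀ {k} → k < n → f k ≈ 0#) → ∑ n f ≈ 0#
  ∑-zero zero    f f≈0 = refl
  ∑-zero (suc n) f f≈0 = trans (+-cong (f≈0 (s≤s z≤n)) (∑-zero n (λ k → f (suc k)) (λ k<n → f≈0 (s≤s k<n)))) (+-identityˡ _)

  ∑-distrib-+ : ∀ n f g → ∑ n (λ k → f k + g k) ≈ ∑ n f + ∑ n g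
  ∑-distrib-+ zero    f g = sym (+-identityˡ _)
  ∑-distrib-+ (suc n) f g = trans (+-congˡ (∑-distrib-+ n (λ k → f (suc k)) (λ k → g (suc k))))
    (solve 4 (λ x y u v → (x :+ y) :+ (u :+ v) := (x :+ u) :+ (y :+ v)) refl _ _ _ _)

  *-distribˡ-∑ : ∀ n x f → x * ∑ n f ≈ ∑ n (λ k → x * f k)
  *-distribˡ-∑ zero    x f = zeroʳ x
  *-distribˡ-∑ (suc n) x f = trans (distribˡ _ _ _) (+-congˡ (*-distribˡ-∑ n x (λ k → f (suc k))))

  ∑-truncate : ∀ {m n} f → m ≤ n → (∀ {k} → m ≤ k → f k ≈ 0#) → ∑ n f ≈ ∑ m f
  ∑-truncate {zero}  {n}     f _         f≈0 = ∑-zero n f (λ _ → f≈0 z≤n)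
  ∑-truncate {suc m} {suc n} f (s≤s m≤n) f≈0 = +-congˡ (∑-truncate (λ k → f (suc k)) m≤n (λ m≤k → f≈0 (s≤s m≤k)))

  ∑-drop : ∀ m {n} f → (∀ {k} → k < m → f k ≈ 0#) → ∑ (m ℕ.+ n) f ≈ ∑ n (λ k → f (m ℕ.+ k))
  ∑-drop zero    f f≈0 = refl
  ∑-drop (suc m) f f≈0 = trans (+-cong (f≈0 (s≤s z≤n)) (∑-drop m (λ k → f (suc k)) (λ k<m → f≈0 (s≤s k<m)))) (+-identityˡ _)

-- Composition of power series, and elements that are not zero divisors

module Composition {c ℓ} (R : CommutativeRing c ℓ) where
  open CommutativeRing R
  open SeriesRing R
  open Sums R
  open PowerSeries rawRing using (_∘_)
  module S = CommutativeRing seriesRing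
  open RawSemiringDefinitions (RawRing.rawSemiring S.rawRing) using () renaming (_^_ to _⊛^_)
  open SetoidReasoning setoid

  scale-*ʳ : ∀ x f g → f S.* scale x g S.≈ scale x (f S.* g)
  scale-*ʳ x f g n = trans (S.*-comm f (scale x g) n) (trans (scale-* x g f n) (*-congˡ (S.*-comm g f n)))

  -- The length N is the same in all degrees, whereas the sum in `_∘_` grows with the degree;
  -- `∘-truncate` passes between the two.
  *-∑ : ∀ N f u (v : ℕ → Series) →
        u S.* (λ n → ∑ N (λ k → f k * v k n)) S.≈ (λ n → ∑ N (λ k → f k * (u S.* v k) n))
  *-∑ zero    f u v = S.zeroʳ u
  *-∑ (suc N) f u v n = trans
    (S.distribˡ u (scale (f 0) (v 0)) (λ n → ∑ N (λ k → f (suc k) * v (suc k) n)) n)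
    (+-cong (scale-*ʳ (f 0) u (v 0) n) (*-∑ N (λ k → f (suc k)) u (λ k → v (suc k)) n))

  constant-cong : ∀ {x y} → x ≈ y → constant x S.≈ constant y
  constant-cong x≈y zero    = x≈y
  constant-cong x≈y (suc n) = refl

  X*-zero : ∀ f → (X S.* f) 0 ≈ 0#
  X*-zero f = trans (+-identityʳ _) (zeroˡ _)

  tail-X : tail X S.≈ S.1#
  tail-X zero    = refl
  tail-X (suc n) = refl

  X*-suc : ∀ f n → (X S.* f) (suc n) ≈ f n
  X*-suc f n = trans (+-cong (zeroˡ _) (S.trans (S.*-congʳ {f} {tail X} {S.1#} tail-X) (S.*-identityˡ f) n)) (+-identityˡ _)

  Regular : Carrier → Set _
  Regular x = ∀ {y} → x * y ≈ 0# → y ≈ 0#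

  SRegular : Series → Set _
  SRegular f = ∀ {g} → f S.* g S.≈ S.0# → g S.≈ S.0#

  -- By induction on the degree: once the lower coefficients of g vanish, the next coefficient of
  -- the product is f 0 times that of g.
  regular-head⇒regular : ∀ {f} → Regular (f 0) → SRegular f
  regular-head⇒regular {f} reg {g} fg≈0 n = upTo n ℕ.≤-refl
    where
    upTo : ∀ n {k} → k ≤ n → g k ≈ 0#
    upTo n       {zero}  _         = reg (trans (sym (+-identityʳ _)) (fg≈0 0))
    upTo (suc n) {suc k} (s≤s k≤n) = reg (begin
      f 0 * g (suc k)                     ≈⟨ +-identityʳ _ ⟨
      f 0 * g (suc k) + 0#                ≈⟨ +-congˡ (zeroˡ-upTo {g} {tail f} k (λ j≤k → upTo n (ℕ.≤-trans j≤k k≤n))) ⟨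
      f 0 * g (suc k) + (g S.* tail f) k  ≈⟨ +-congˡ (S.*-comm g (tail f) k) ⟩
      (f S.* g) (suc k)                   ≈⟨ fg≈0 (suc k) ⟩
      0#                                  ∎)

  X-regular : SRegular X
  X-regular {g} Xg≈0 n = trans (sym (X*-suc g n)) (Xg≈0 (suc n))

  ∘-congʳ : ∀ {f f′} g → f S.≈ f′ → f ∘ g S.≈ f′ ∘ g
  ∘-congʳ {f} {f′} g f≈f′ n = ∑-cong (suc n) (λ k → f k * (g ⊛^ k) n) (λ k → f′ k * (g ⊛^ k) n) (λ {k} _ → *-congʳ (f≈f′ k))

  ∘-+ : ∀ f f′ g → (f S.+ f′) ∘ g S.≈ f ∘ g S.+ f′ ∘ g
  ∘-+ f f′ g n = trans
    (∑-cong (suc n) (λ k → (f k + f′ k) * (g ⊛^ k) n) (λ k → f k * (g ⊛^ k) n + f′ k * (g ⊛^ k) n) (λ _ → distribʳ _ _ _))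
    (∑-distrib-+ (suc n) (λ k → f k * (g ⊛^ k) n) (λ k → f′ k * (g ⊛^ k) n))

  ∘-scale : ∀ x f g → scale x f ∘ g S.≈ scale x (f ∘ g)
  ∘-scale x f g n = trans
    (∑-cong (suc n) (λ k → (x * f k) * (g ⊛^ k) n) (λ k → x * (f k * (g ⊛^ k) n)) (λ _ → *-assoc _ _ _))
    (sym (*-distribˡ-∑ (suc n) x (λ k → f k * (g ⊛^ k) n)))

  module _ {g : Series} (g₀≈0 : g 0 ≈ 0#) where

    -- As g has no constant term, degree n of the product sees u only below n. This strict drop
    -- drives the inductions on the degree.
    *-cong-below : ∀ {u v} n → (∀ {k} → k < n → u k ≈ v k) → (g S.* u) n ≈ (g S.* v) n
    *-cong-below zero            u≈v = +-congʳ (trans (trans (*-congʳ g₀≈0) (zeroˡ _)) (sym (trans (*-congʳ g₀≈0) (zeroˡ _))))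
    *-cong-below {u} {v} (suc n) u≈v = +-cong
      (trans (trans (*-congʳ g₀≈0) (zeroˡ _)) (sym (trans (*-congʳ g₀≈0) (zeroˡ _))))
      (*-cong-upTo {tail g} {tail g} {u} {v} n (λ _ → refl) (λ k≤n → u≈v (s≤s k≤n)))

    ^-low : ∀ {n k} → n < k → (g ⊛^ k) n ≈ 0#
    ^-low {n} {suc k} n<1+k = trans
      (*-cong-below {g ⊛^ k} {S.0#} n (λ j<n → ^-low (ℕ.<-≤-trans j<n (s≤s⁻¹ n<1+k))))
      (S.zeroʳ g n)

    ∘-truncate : ∀ f {n N} → n < N → ∑ N (λ k → f k * (g ⊛^ k) n) ≈ (f ∘ g) n
    ∘-truncate f {n} n<N = ∑-truncate (λ k → f k * (g ⊛^ k) n) n<N (λ n<k → trans (*-congˡ (^-low n<k)) (zeroʳ _))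

    -- Horner's rule: f = f 0 + t (tail f), with g substituted for t.
    ∘-unfold : ∀ f → f ∘ g S.≈ constant (f 0) S.+ g S.* (tail f ∘ g)
    ∘-unfold f zero = +-cong (*-identityʳ _) (sym (trans (+-identityʳ _) (trans (*-congʳ g₀≈0) (zeroˡ _))))
    ∘-unfold f (suc n) = +-cong (zeroʳ _) (begin
      ∑ (suc n) (λ k → f (suc k) * (g S.* (g ⊛^ k)) (suc n))
        ≈⟨ *-∑ (suc n) (tail f) g (g ⊛^_) (suc n) ⟨
      (g S.* (λ m → ∑ (suc n) (λ k → f (suc k) * (g ⊛^ k) m))) (suc n)
        ≈⟨ *-cong-below (suc n) (λ k<1+n → ∘-truncate (tail f) k<1+n) ⟩
      (g S.* (tail f ∘ g)) (suc n)  ∎)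

    -- Both sides unfold to the same constant plus g times a remainder, and the remainders agree in
    -- lower degrees by the same statement for `tail f`.
    ∘-* : ∀ f f′ → (f S.* f′) ∘ g S.≈ (f ∘ g) S.* (f′ ∘ g)
    ∘-* f f′ n = below (suc n) f ℕ.≤-refl
      where
      rhs : ∀ f → (f ∘ g) S.* (f′ ∘ g) S.≈
            constant ((f S.* f′) 0) S.+ g S.* (scale (f 0) (tail f′ ∘ g) S.+ (tail f ∘ g) S.* (f′ ∘ g))
      rhs f = S.trans (S.*-congʳ {f′ ∘ g} {f ∘ g} {constant (f 0) S.+ g S.* (tail f ∘ g)} (∘-unfold f))
        (S.trans (S.distribʳ (f′ ∘ g) (constant (f 0)) (g S.* (tail f ∘ g)))
        (S.trans (S.+-cong
           (S.trans (constant-* (f 0) (f′ ∘ g)) λ n → trans (*-congˡ (∘-unfold f′ n)) (distribˡ _ _ _))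
           (S.*-assoc g (tail f ∘ g) (f′ ∘ g)))
        (S.trans (S.+-assoc (scale (f 0) (constant (f′ 0))) (scale (f 0) (g S.* (tail f′ ∘ g))) (g S.* ((tail f ∘ g) S.* (f′ ∘ g))))
        (S.+-cong head
          (S.trans (S.+-congʳ {g S.* ((tail f ∘ g) S.* (f′ ∘ g))} (S.sym (scale-*ʳ (f 0) g (tail f′ ∘ g))))
            (S.sym (S.distribˡ g (scale (f 0) (tail f′ ∘ g)) ((tail f ∘ g) S.* (f′ ∘ g)))))))))
        where
        head : scale (f 0) (constant (f′ 0)) S.≈ constant ((f S.* f′) 0)
        head zero    = sym (+-identityʳ _)
        head (suc n) = zeroʳ _
      -- The induction is on a bound N for the degree, since f changes to its tail on the way.
      below : ∀ N f {n} → n < N → ((f S.* f′) ∘ g) n ≈ ((f ∘ g) S.* (f′ ∘ g)) n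
      below (suc N) f {n} n<1+N = trans (∘-unfold (f S.* f′) n) (trans
        (+-congˡ (*-cong-below n λ {k} k<n → trans (∘-+ (scale (f 0) (tail f′)) (tail f S.* f′) g k)
          (+-cong (∘-scale (f 0) (tail f′) g k) (below N (tail f) (ℕ.<-≤-trans k<n (s≤s⁻¹ n<1+N))))))
        (sym (rhs f n)))

    1∘ : S.1# ∘ g S.≈ S.1#
    1∘ n = trans (∘-unfold S.1# n) (trans (+-congˡ (trans
        (S.*-congˡ {g} {S.0# ∘ g} {S.0#} (λ m → ∑-zero (suc m) (λ k → 0# * (g ⊛^ k) m) (λ _ → zeroˡ _)) n)
        (S.zeroʳ g n))) (+-identityʳ _))

    X∘ : X ∘ g S.≈ g
    X∘ n = trans (∘-unfold X n) (trans (+-cong (S.trans (constant-cong refl) zeroSeries n) (trans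
        (S.*-congˡ {g} {tail X ∘ g} {S.1#} (S.trans (∘-congʳ g tail-X) 1∘) n)
        (S.*-identityʳ g n))) (+-identityˡ _))
      where
      zeroSeries : constant 0# S.≈ S.0#
      zeroSeries zero    = refl
      zeroSeries (suc _) = refl

-- The tuples in S as walks

-- A tuple is read as the walk with steps n_j - 1.  staysUp m: started at height
-- m - 1, the walk is never negative and ends at 0, so that m = 0 is a dead state.
staysUp : ∀ {s} → ℕ → Vec ℕ s → Bool
staysUp m       []       = m ≡ᵇ 1
staysUp zero    (n ∷ ns) = false
staysUp (suc m) (n ∷ ns) = staysUp (m ℕ.+ n) ns

-- The walk is started at height -k, is negative after each of its first p steps
-- and nonnegative after every later one, and ends at 0.
crosses : ∀ {r} (p k : ℕ) → Vec ℕ r → Bool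
crosses p       k []       = false
crosses zero    k (n ∷ ns) = staysUp (n ∸ k) ns
crosses (suc p) k (n ∷ ns) = (n ≤ᵇ k) ∧ crosses p (suc k ∸ n) ns

sum-toList : ∀ {s} (ns : Vec ℕ s) → ListAction.sum (Vec.toList ns) ≡ Vec.sum ns
sum-toList []       = ≡.refl
sum-toList (n ∷ ns) = ≡.cong (n ℕ.+_) (sum-toList ns)

-- A walk ending at 0 has height s - j minus the j-th suffix sum after j steps, so the suffix bounds
-- say that it is never negative; j = 0 covers its start.
Up : ∀ {s} → ℕ → Vec ℕ s → Set
Up {s} m ns = (m ℕ.+ Vec.sum ns ≡ suc s) × (∀ {j} → j < s → suffixSum j ns ≤ s ∸ j)

Up⇒staysUp : ∀ {s} m (ns : Vec ℕ s) → Up m ns → T (staysUp m ns)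
Up⇒staysUp m       []       (m≡1 , _)    = ℕ.≡⇒≡ᵇ m 1 (≡.trans (≡.sym (ℕ.+-identityʳ m)) m≡1)
-- From height -1 the entries would have to sum to one more than the number of steps, which the
-- bound at j = 0 forbids.
Up⇒staysUp {suc s} zero (n ∷ ns) (sum≡ , low) = ℕ.1+n≰n {suc s}
  (≡.subst (_≤ suc s) (≡.trans (≡.cong (n ℕ.+_) (sum-toList ns)) sum≡) (low (s≤s z≤n)))
Up⇒staysUp (suc m) (n ∷ ns) (sum≡ , low) =
  Up⇒staysUp (m ℕ.+ n) ns (≡.trans (ℕ.+-assoc m n _) (ℕ.suc-injective sum≡) , λ j<s → low (s≤s j<s))

staysUp⇒Up : ∀ {s} m (ns : Vec ℕ s) → T (staysUp m ns) → Up m ns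
staysUp⇒Up m       []       up = ≡.trans (ℕ.+-identityʳ m) (ℕ.≡ᵇ⇒≡ m 1 up) , λ ()
staysUp⇒Up (suc m) (n ∷ ns) up with staysUp⇒Up (m ℕ.+ n) ns up
... | sum≡ , low = ≡.cong suc sum≡′ , λ
  { {zero}  _         → ℕ.≤-trans (ℕ.≤-reflexive (≡.cong (n ℕ.+_) (sum-toList ns)))
                          (ℕ.≤-trans (ℕ.m≤n+m _ m) (ℕ.≤-reflexive sum≡′))
  ; {suc j} (s≤s j<s) → low j<s
  }
  where sum≡′ = ≡.trans (≡.sym (ℕ.+-assoc m n _)) sum≡

-- From height -k, the height after j steps is the prefix sum minus j + k. Step p + 1 is the
-- crossing and s steps follow. For k = 0 these are the conditions of `InS (suc p)`, up to adding 0.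
Crosses : ∀ (p s k : ℕ) → Vec ℕ (suc (p ℕ.+ s)) → Set
Crosses p s k ns =
    Vec.sum ns ≡ suc (p ℕ.+ s) ℕ.+ k
  × (∀ {j} → j < suc p → 1 ≤ j → prefixSum j ns < j ℕ.+ k)
  × (∀ {j} → j < suc (p ℕ.+ s) → suc p ≤ j → suffixSum j ns ≤ suc (p ℕ.+ s) ∸ j)

sum≤ : ∀ {s} (ns : Vec ℕ s) → (∀ {j} → j < s → suffixSum j ns ≤ s ∸ j) → Vec.sum ns ≤ s
sum≤ []       low = z≤n
sum≤ (n ∷ ns) low = ℕ.≤-trans (ℕ.≤-reflexive (≡.cong (n ℕ.+_) (≡.sym (sum-toList ns)))) (low (s≤s z≤n))

private
  [n∸k]+t+k≡n+t : ∀ {n k t} → k ≤ n → (n ∸ k) ℕ.+ t ℕ.+ k ≡ n ℕ.+ t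
  [n∸k]+t+k≡n+t {n} {k} {t} k≤n = ≡.trans
    (solve 3 (λ d t k → d :+ t :+ k := d :+ k :+ t) ≡.refl (n ∸ k) t k)
    (≡.cong (ℕ._+ t) (ℕ.m∸n+n≡m k≤n))
    where open +-*-Solver

  -- An entry n turns depth k into depth `suc k ∸ n`; this carries bounds between a tuple and its
  -- tail.
  1+j+k≡n+[j+[1+k∸n]] : ∀ {n k} → n ≤ k → ∀ j → suc j ℕ.+ k ≡ n ℕ.+ (j ℕ.+ (suc k ∸ n))
  1+j+k≡n+[j+[1+k∸n]] {n} {k} n≤k j = ≡.trans (≡.sym (ℕ.+-suc j k)) (≡.trans (≡.cong (j ℕ.+_) (≡.sym (ℕ.m+[n∸m]≡n (ℕ.m≤n⇒m≤1+n n≤k))))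
    (solve 3 (λ j n d → j :+ (n :+ d) := n :+ (j :+ d)) ≡.refl j n (suc k ∸ n)))
    where open +-*-Solver

Crosses⇒crosses : ∀ p s k (ns : Vec ℕ (suc (p ℕ.+ s))) → Crosses p s k ns → T (crosses p k ns)
Crosses⇒crosses zero s k (n ∷ ns) (sum≡ , _ , low) = Up⇒staysUp (n ∸ k) ns
  (ℕ.+-cancelʳ-≡ k _ _ (≡.trans ([n∸k]+t+k≡n+t k≤n) sum≡) , low′)
  where
  low′ : ∀ {j} → j < s → suffixSum j ns ≤ s ∸ j
  low′ j<s = low (s≤s j<s) (s≤s z≤n)
  -- The entries after the crossing add up to at most s, so n has to make up for the depth k; thus
  -- `n ∸ k` is a true difference.
  k≤n : k ≤ n
  k≤n = ℕ.+-cancelʳ-≤ s k n (begin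
    k ℕ.+ s          ≡⟨ ℕ.+-comm k s ⟩
    s ℕ.+ k          ≤⟨ ℕ.n≤1+n _ ⟩
    suc (s ℕ.+ k)    ≡⟨ sum≡ ⟨
    n ℕ.+ Vec.sum ns ≤⟨ ℕ.+-monoʳ-≤ n (sum≤ ns low′) ⟩
    n ℕ.+ s          ∎)
    where open ℕ.≤-Reasoning
Crosses⇒crosses (suc p) s k (n ∷ ns) (sum≡ , neg , low) = Equivalence.from T-∧
  ( ℕ.≤⇒≤ᵇ n≤k
  , Crosses⇒crosses p s (suc k ∸ n) ns
    ( ℕ.+-cancelˡ-≡ n _ _ (≡.trans sum≡ (1+j+k≡n+[j+[1+k∸n]] n≤k (suc (p ℕ.+ s))))
    , (λ {j} j<1+p _ → ℕ.+-cancelˡ-< n _ _ (≡.subst (suc (n ℕ.+ prefixSum j ns) ≤_) (1+j+k≡n+[j+[1+k∸n]] n≤k j) (neg (s≤s j<1+p) (s≤s z≤n))))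
    , (λ j<r p<j → low (s≤s j<r) (s≤s p<j))
    )
  )
  where
  n≤k : n ≤ k
  n≤k = s≤s⁻¹ (≡.subst (_< suc k) (ℕ.+-identityʳ n) (neg (s≤s (s≤s z≤n)) (s≤s z≤n)))

crosses⇒Crosses : ∀ p s k (ns : Vec ℕ (suc (p ℕ.+ s))) → T (crosses p k ns) → Crosses p s k ns
crosses⇒Crosses zero s k (n ∷ ns) cr with staysUp⇒Up (n ∸ k) ns cr
... | sum≡ , low = ≡.trans (≡.sym ([n∸k]+t+k≡n+t k≤n)) (≡.cong (ℕ._+ k) sum≡)
                 , (λ { (s≤s z≤n) () })
                 , (λ { {suc j} (s≤s j<s) _ → low j<s })
  where
  -- If n < k, the rest would start in the dead state and sum to s + 1, against `sum≤`.
  k≤n : k ≤ n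
  k≤n = ℕ.≮⇒≥ λ n<k → ℕ.1+n≰n (ℕ.≤-trans
    (ℕ.≤-reflexive (≡.trans (≡.sym sum≡) (≡.cong (ℕ._+ Vec.sum ns) (ℕ.m≤n⇒m∸n≡0 (ℕ.<⇒≤ n<k)))))
    (sum≤ ns low))
crosses⇒Crosses (suc p) s k (n ∷ ns) cr with Equivalence.to (T-∧ {n ≤ᵇ k}) cr
... | n≤ᵇk , cr′ with crosses⇒Crosses p s (suc k ∸ n) ns cr′
... | sum≡ , neg , low =
    ≡.trans (≡.cong (n ℕ.+_) sum≡) (≡.sym (1+j+k≡n+[j+[1+k∸n]] n≤k (suc (p ℕ.+ s))))
  -- The bound at j = 1 is the Boolean test on n; the later ones come from the tail.
  , (λ { {suc zero} _ _ → s≤s (≡.subst (_≤ k) (≡.sym (ℕ.+-identityʳ n)) n≤k)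
       ; {suc (suc j)} (s≤s j<) _ → ≡.subst (suc (n ℕ.+ prefixSum (suc j) ns) ≤_) (≡.sym (1+j+k≡n+[j+[1+k∸n]] n≤k (suc j)))
           (ℕ.+-monoʳ-< n (neg j< (s≤s z≤n))) })
  , (λ { {suc j} (s≤s j<r) (s≤s p<j) → low j<r p<j })
  where
  n≤k : n ≤ k
  n≤k = ℕ.≤ᵇ⇒≤ n k n≤ᵇk

-- Membership becomes a Boolean function defined by recursion on the tuple, which sums over tuples
-- can follow entry by entry.
S≡filter-crosses : ∀ p s → S (suc p) (suc (p ℕ.+ s)) ≡
  filter (λ ns → T? (crosses p 0 ns)) (tuples (suc (p ℕ.+ s)) (suc (p ℕ.+ s)))
S≡filter-crosses p s = filter-≐ (InS? (suc p)) (λ ns → T? (crosses p 0 ns))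
  ( (λ {ns} (sum≡ , neg , low) → Crosses⇒crosses p s 0 ns
      (≡.trans sum≡ (≡.sym (ℕ.+-identityʳ _))
      , (λ {j} j<i 1≤j → ≡.subst (prefixSum j ns <_) (≡.sym (ℕ.+-identityʳ j)) (neg j<i 1≤j)) , low))
  , (λ {ns} cr → let (sum≡ , neg , low) = crosses⇒Crosses p s 0 ns cr in
      ≡.trans sum≡ (ℕ.+-identityʳ _)
      , (λ {j} j<i 1≤j → ≡.subst (prefixSum j ns <_) (ℕ.+-identityʳ j) (neg j<i 1≤j)) , low)
  ) (tuples (suc (p ℕ.+ s)) (suc (p ℕ.+ s)))

-- Weighted counts of walks and Lagrange inversion

module Walks {c ℓ} (R : CommutativeRing c ℓ) where
  open CommutativeRing R
  open SeriesRing R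
  open Composition R
  open Sums R
  open PowerSeries rawRing using (_∘_)
  open RawSemiringDefinitions (RawRing.rawSemiring rawRing) using (product)
  open RawSemiringDefinitions (RawRing.rawSemiring S.rawRing) using () renaming (_^_ to _⊛^_)
  open SemiringSolver commutativeSemiring using (solve; _:*_; _:=_)
  open SetoidReasoning setoid

  -- For f = γ this is the series γ_k of the overview.
  drop : ℕ → Series → Series
  drop k f n = f (k ℕ.+ n)

  module _ (γ : Series) where

    weight : ∀ {k} → Vec ℕ k → Carrier
    weight {k} ns = product λ (j : Fin k) → γ (Vec.lookup ns j)

    -- The predicate is Boolean so that the filter reduces once its value at the first tuple is
    -- known.
    total : ∀ {k} → (Vec ℕ k → Bool) → List (Vec ℕ k) → Carrier
    total p nss = foldr _+_ 0# (map weight (filter (λ ns → T? (p ns)) nss))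

    total-∷ : ∀ {k} (p : Vec ℕ (suc k) → Bool) n nss → total p (map (n ∷_) nss) ≈ γ n * total (λ ns → p (n ∷ ns)) nss
    total-∷ p n []         = sym (zeroʳ _)
    total-∷ p n (ns ∷ nss) with p (n ∷ ns)
    ... | false = total-∷ p n nss
    ... | true  = trans (+-congˡ (total-∷ p n nss)) (sym (distribˡ _ _ _))

    total-++ : ∀ {k} (p : Vec ℕ k → Bool) nss nss′ → total p (nss ++ nss′) ≈ total p nss + total p nss′
    total-++ p []         nss′ = sym (+-identityˡ _)
    total-++ p (ns ∷ nss) nss′ with p ns
    ... | false = total-++ p nss nss′
    ... | true  = trans (+-congˡ (total-++ p nss nss′)) (sym (+-assoc _ _ _))

    -- The enumeration `f` is arbitrary because the recursion of `applyUpTo` shifts it.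
    total-cartesianProduct : ∀ {k} (p : Vec ℕ (suc k) → Bool) f m nss →
      total p (cartesianProductWith _∷_ (applyUpTo f m) nss) ≈ ∑ m (λ j → γ (f j) * total (λ ns → p (f j ∷ ns)) nss)
    total-cartesianProduct p f zero    nss = refl
    total-cartesianProduct p f (suc m) nss = trans
      (total-++ p (map (f 0 ∷_) nss) (cartesianProductWith _∷_ (applyUpTo (λ j → f (suc j)) m) nss))
      (+-cong (total-∷ p (f 0) nss) (total-cartesianProduct p (λ j → f (suc j)) m nss))

    total-suc : ∀ b k (p : Vec ℕ (suc k) → Bool) →
      total p (tuples b (suc k)) ≈ ∑ (suc b) (λ n → γ n * total (λ ns → p (n ∷ ns)) (tuples b k))
    total-suc b k p = total-cartesianProduct p (λ j → j) (suc b) (tuples b k)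

    total-false : ∀ {k} (nss : List (Vec ℕ k)) → total (λ _ → false) nss ≈ 0#
    total-false []         = refl
    total-false (ns ∷ nss) = total-false nss

    -- In the generating function over the starting depth k, prepending a step to
    -- `crosses` is f ↦ γ * tail f.
    iterate : ℕ → Series → Series
    iterate zero    f = f
    iterate (suc p) f = γ S.* tail (iterate p f)

    module _ {M : Series} (M₀≈0 : M 0 ≈ 0#) (M≈Xγ[M] : M S.≈ X S.* (γ ∘ M)) where

      -- M^(m+1) = t γ(M) M^m, read off in one degree. This matches the first step of a walk in
      -- `staysUp (suc m)`, where an entry k leads to `m + k`.
      ^-suc : ∀ m n → (M ⊛^ suc m) (suc n) ≈ ∑ (suc n) (λ k → γ k * (M ⊛^ (m ℕ.+ k)) n)
      ^-suc m n = begin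
        (M S.* (M ⊛^ m)) (suc n)             ≈⟨ S.*-congʳ {M ⊛^ m} M≈Xγ[M] (suc n) ⟩
        ((X S.* (γ ∘ M)) S.* (M ⊛^ m)) (suc n)
          ≈⟨ S.trans (S.*-assoc X (γ ∘ M) (M ⊛^ m)) (S.*-congˡ {X} (S.*-comm (γ ∘ M) (M ⊛^ m))) (suc n) ⟩
        (X S.* ((M ⊛^ m) S.* (γ ∘ M))) (suc n)  ≈⟨ X*-suc ((M ⊛^ m) S.* (γ ∘ M)) n ⟩
        ((M ⊛^ m) S.* (γ ∘ M)) n
          -- A single sum of length n + 1 represents γ(M) in all degrees up to n, so that `*-∑`
          -- applies.
          ≈⟨ *-cong-upTo {M ⊛^ m} {M ⊛^ m} {λ j → ∑ (suc n) (λ k → γ k * (M ⊛^ k) j)} {γ ∘ M} n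
               (λ _ → refl) (λ k≤n → ∘-truncate M₀≈0 γ (s≤s k≤n)) ⟨
        ((M ⊛^ m) S.* (λ j → ∑ (suc n) (λ k → γ k * (M ⊛^ k) j))) n
          ≈⟨ *-∑ (suc n) γ (M ⊛^ m) (M ⊛^_) n ⟩
        ∑ (suc n) (λ k → γ k * ((M ⊛^ m) S.* (M ⊛^ k)) n)
          ≈⟨ ∑-cong (suc n) (λ k → γ k * ((M ⊛^ m) S.* (M ⊛^ k)) n) (λ k → γ k * (M ⊛^ (m ℕ.+ k)) n)
               (λ {k} _ → *-congˡ (sym (Exp.^-homo-* S.semiring M m k n))) ⟩
        ∑ (suc n) (λ k → γ k * (M ⊛^ (m ℕ.+ k)) n)  ∎

      ∑-^-truncate : ∀ (f : Series) m {n N} → n < N → ∑ N (λ k → f k * (M ⊛^ (m ℕ.+ k)) n) ≈ ∑ (suc n) (λ k → f k * (M ⊛^ (m ℕ.+ k)) n)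
      ∑-^-truncate f m {n} n<N = ∑-truncate (λ k → f k * (M ⊛^ (m ℕ.+ k)) n) n<N
        (λ {k} n<k → trans (*-congˡ (^-low {M} M₀≈0 (ℕ.<-≤-trans n<k (ℕ.m≤n+m k m)))) (zeroʳ _))

      *-∑-γ : ∀ N x (t : ℕ → Carrier) → x * ∑ N (λ k → γ k * t k) ≈ ∑ N (λ k → γ k * (x * t k))
      *-∑-γ N x t = trans (*-distribˡ-∑ N x (λ k → γ k * t k))
        (∑-cong N (λ k → x * (γ k * t k)) (λ k → γ k * (x * t k))
          (λ _ → solve 3 (λ x y z → x :* (y :* z) := y :* (x :* z)) refl _ _ _))

      -- Appending an entry 0, of weight γ 0, takes the walk to -1 for the first time. Such a first
      -- passage descends m levels, each contributing a factor M; the induction matches first steps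
      -- with `^-suc`.
      total-staysUp : ∀ s m {b} → s ≤ b → γ 0 * total (staysUp m) (tuples b s) ≈ (M ⊛^ m) (suc s)
      total-staysUp zero    zero          _ = zeroʳ _
      total-staysUp zero    (suc zero)    _ = begin
        γ 0 * (1# + 0#)        ≈⟨ *-congˡ (+-identityʳ _) ⟩
        γ 0 * 1#               ≈⟨ +-identityʳ _ ⟨
        (γ ∘ M) 0              ≈⟨ X*-suc (γ ∘ M) 0 ⟨
        (X S.* (γ ∘ M)) 1      ≈⟨ M≈Xγ[M] 1 ⟨
        M 1                    ≈⟨ S.*-identityʳ M 1 ⟨
        (M S.* S.1#) 1         ∎
      total-staysUp zero    (suc (suc m)) _ = trans (zeroʳ _) (sym (^-low {M} M₀≈0 {1} {suc (suc m)} (s≤s (s≤s z≤n))))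
      total-staysUp (suc s) zero    {b} _   = trans (*-congˡ (trans (total-suc b s (staysUp 0))
        (∑-zero (suc b) (λ n → γ n * total (λ _ → false) (tuples b s)) (λ _ → trans (*-congˡ (total-false (tuples b s))) (zeroʳ _)))))
        (zeroʳ _)
      total-staysUp (suc s) (suc m) {b} s<b = begin
        γ 0 * total (staysUp (suc m)) (tuples b (suc s))
          ≈⟨ *-congˡ (total-suc b s (staysUp (suc m))) ⟩
        γ 0 * ∑ (suc b) (λ n → γ n * total (staysUp (m ℕ.+ n)) (tuples b s))
          ≈⟨ *-∑-γ (suc b) (γ 0) (λ n → total (staysUp (m ℕ.+ n)) (tuples b s)) ⟩
        ∑ (suc b) (λ n → γ n * (γ 0 * total (staysUp (m ℕ.+ n)) (tuples b s)))
          ≈⟨ ∑-cong (suc b) (λ n → γ n * (γ 0 * total (staysUp (m ℕ.+ n)) (tuples b s))) (λ n → γ n * (M ⊛^ (m ℕ.+ n)) (suc s))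
               (λ {n} _ → *-congˡ (total-staysUp s (m ℕ.+ n) (ℕ.<⇒≤ s<b))) ⟩
        ∑ (suc b) (λ n → γ n * (M ⊛^ (m ℕ.+ n)) (suc s))
          ≈⟨ ∑-^-truncate γ m (s≤s s<b) ⟩
        ∑ (suc (suc s)) (λ n → γ n * (M ⊛^ (m ℕ.+ n)) (suc s))
          ≈⟨ ^-suc m (suc s) ⟨
        (M ⊛^ suc m) (suc (suc s))  ∎

      -- γ 0 times the total weight of the walks which start at height -k and
      -- become nonnegative with their first step.
      jump : ℕ → Series
      jump s k = (drop k γ ∘ M) (suc s)

      -- A crossing step n leaves a walk counted by M^(n-k), and summing over n gives γ_k(M). An
      -- earlier step n ≤ k leads to depth k + 1 - n, hence a convolution with γ. The lower bound
      -- for b is the sum of all entries, so no tuple is missed.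
      total-crosses : ∀ p s k {b} → p ℕ.+ suc s ℕ.+ k ≤ b →
        γ 0 * total (crosses p k) (tuples b (suc (p ℕ.+ s))) ≈ iterate p (jump s) k
      total-crosses zero s k {b} s+k<b = begin
        γ 0 * total (crosses 0 k) (tuples b (suc s))
          ≈⟨ *-congˡ (total-suc b s (crosses 0 k)) ⟩
        γ 0 * ∑ (suc b) (λ n → γ n * total (staysUp (n ∸ k)) (tuples b s))
          ≈⟨ *-∑-γ (suc b) (γ 0) (λ n → total (staysUp (n ∸ k)) (tuples b s)) ⟩
        ∑ (suc b) (λ n → γ n * (γ 0 * total (staysUp (n ∸ k)) (tuples b s)))
          ≈⟨ ∑-cong (suc b) (λ n → γ n * (γ 0 * total (staysUp (n ∸ k)) (tuples b s))) (λ n → γ n * (M ⊛^ (n ∸ k)) (suc s))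
               (λ {n} _ → *-congˡ (total-staysUp s (n ∸ k) (ℕ.≤-trans (ℕ.n≤1+n s) (ℕ.m+n≤o⇒m≤o (suc s) s+k<b)))) ⟩
        ∑ (suc b) (λ n → γ n * (M ⊛^ (n ∸ k)) (suc s))
          ≡⟨ ≡.cong (λ N → ∑ N (λ n → γ n * (M ⊛^ (n ∸ k)) (suc s))) (ℕ.m+[n∸m]≡n (ℕ.m≤n⇒m≤1+n k≤b)) ⟨
        ∑ (k ℕ.+ (suc b ∸ k)) (λ n → γ n * (M ⊛^ (n ∸ k)) (suc s))
          -- For n < k the truncated exponent is 0, and 1 has no coefficient in degree s + 1.
          ≈⟨ ∑-drop k (λ n → γ n * (M ⊛^ (n ∸ k)) (suc s)) (λ {n} n<k →
               trans (*-congˡ (reflexive (≡.cong (λ m → (M ⊛^ m) (suc s)) (ℕ.m≤n⇒m∸n≡0 (ℕ.<⇒≤ n<k))))) (zeroʳ _)) ⟩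
        ∑ (suc b ∸ k) (λ n → γ (k ℕ.+ n) * (M ⊛^ (k ℕ.+ n ∸ k)) (suc s))
          ≈⟨ ∑-cong (suc b ∸ k) (λ n → γ (k ℕ.+ n) * (M ⊛^ (k ℕ.+ n ∸ k)) (suc s)) (λ n → γ (k ℕ.+ n) * (M ⊛^ n) (suc s))
               (λ {n} _ → *-congˡ (reflexive (≡.cong (λ m → (M ⊛^ m) (suc s)) (ℕ.m+n∸m≡n k n)))) ⟩
        ∑ (suc b ∸ k) (λ n → γ (k ℕ.+ n) * (M ⊛^ n) (suc s))
          ≈⟨ ∘-truncate M₀≈0 (drop k γ) (ℕ.m+n≤o⇒m≤o∸n (suc (suc s)) (s≤s s+k<b)) ⟩
        (drop k γ ∘ M) (suc s)  ∎
        where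
        k≤b : k ≤ b
        k≤b = ℕ.m+n≤o⇒n≤o (suc s) s+k<b
      total-crosses (suc p) s k {b} bound = begin
        γ 0 * total (crosses (suc p) k) (tuples b (suc (suc p ℕ.+ s)))
          ≈⟨ *-congˡ (total-suc b (suc p ℕ.+ s) (crosses (suc p) k)) ⟩
        γ 0 * ∑ (suc b) (λ n → γ n * rest n)
          ≈⟨ *-∑-γ (suc b) (γ 0) rest ⟩
        ∑ (suc b) (λ n → γ n * (γ 0 * rest n))
          -- Entries n > k fail the test; what remains is the defining sum of the product with γ.
          ≈⟨ ∑-truncate (λ n → γ n * (γ 0 * rest n)) (s≤s k≤b)
               (λ k<n → trans (*-congˡ (trans (*-congˡ (rest≈0 k<n)) (zeroʳ _))) (zeroʳ _)) ⟩
        ∑ (suc k) (λ n → γ n * (γ 0 * rest n))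
          ≈⟨ ∑-cong (suc k) (λ n → γ n * (γ 0 * rest n)) (λ n → γ n * tail (iterate p (jump s)) (k ∸ n))
               (λ n<1+k → *-congˡ (rest≈ (s≤s⁻¹ n<1+k))) ⟩
        (γ S.* tail (iterate p (jump s))) k  ∎
        where
        rest : ℕ → Carrier
        rest n = total (λ ns → (n ≤ᵇ k) ∧ crosses p (suc k ∸ n) ns) (tuples b (suc (p ℕ.+ s)))
        k≤b : k ≤ b
        k≤b = ℕ.m+n≤o⇒n≤o (suc p ℕ.+ suc s) bound
        rest≈0 : ∀ {n} → k < n → rest n ≈ 0#
        rest≈0 {n} k<n with n ≤ᵇ k in eq
        ... | false = total-false (tuples b (suc (p ℕ.+ s)))
        ... | true  = contradiction (ℕ.≤ᵇ⇒≤ n k (≡.subst T (≡.sym eq) tt)) (ℕ.<⇒≱ k<n)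
        rest≈ : ∀ {n} → n ≤ k → γ 0 * rest n ≈ tail (iterate p (jump s)) (k ∸ n)
        rest≈ {n} n≤k with n ≤ᵇ k in eq
        ... | false = ⊥-elim (≡.subst T eq (ℕ.≤⇒≤ᵇ n≤k))
        -- The depth grows by at most 1 while p drops by 1, so the bound for b persists.
        ... | true  = trans (total-crosses p s (suc k ∸ n) (ℕ.≤-trans
                (ℕ.+-monoʳ-≤ (p ℕ.+ suc s) (ℕ.m∸n≤m (suc k) n)) (ℕ.≤-trans (ℕ.≤-reflexive (ℕ.+-suc _ k)) bound)))
          (reflexive (≡.cong (iterate p (jump s)) (ℕ.+-∸-assoc 1 n≤k)))

      -- For h = `iterate q f`, h(M) = h 0 + t γ(M) (tail h)(M), so degree p + 1 of h(M) is degree p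
      -- of (γ tail h)(M). Each round trades a degree for an iteration, until a constant term is
      -- left.
      lagrange : ∀ p q f → (iterate q f ∘ M) p ≈ iterate (p ℕ.+ q) f 0
      lagrange zero    q f = trans (+-identityʳ _) (*-identityʳ _)
      lagrange (suc p) q f = begin
        (iterate q f ∘ M) (suc p)                           ≈⟨ ∘-unfold M₀≈0 (iterate q f) (suc p) ⟩
        0# + (M S.* (tail (iterate q f) ∘ M)) (suc p)       ≈⟨ +-identityˡ _ ⟩
        (M S.* (tail (iterate q f) ∘ M)) (suc p)            ≈⟨ S.*-congʳ {tail (iterate q f) ∘ M} M≈Xγ[M] (suc p) ⟩
        ((X S.* (γ ∘ M)) S.* (tail (iterate q f) ∘ M)) (suc p)
          ≈⟨ S.*-assoc X (γ ∘ M) (tail (iterate q f) ∘ M) (suc p) ⟩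
        (X S.* ((γ ∘ M) S.* (tail (iterate q f) ∘ M))) (suc p)
          ≈⟨ X*-suc ((γ ∘ M) S.* (tail (iterate q f) ∘ M)) p ⟩
        ((γ ∘ M) S.* (tail (iterate q f) ∘ M)) p            ≈⟨ ∘-* M₀≈0 γ (tail (iterate q f)) p ⟨
        (iterate (suc q) f ∘ M) p                           ≈⟨ lagrange p (suc q) f ⟩
        iterate (p ℕ.+ suc q) f 0                           ≡⟨ ≡.cong (λ m → iterate m f 0) (ℕ.+-suc p q) ⟩
        iterate (suc (p ℕ.+ q)) f 0                         ∎

      total-S : ∀ p s → let r = suc (p ℕ.+ s) in
        γ 0 * foldr _+_ 0# (map weight (S (suc p) r)) ≈ (jump s ∘ M) p
      total-S p s = begin
        γ 0 * foldr _+_ 0# (map weight (S (suc p) (suc (p ℕ.+ s))))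
          ≡⟨ ≡.cong (λ nss → γ 0 * foldr _+_ 0# (map weight nss)) (S≡filter-crosses p s) ⟩
        γ 0 * total (crosses p 0) (tuples (suc (p ℕ.+ s)) (suc (p ℕ.+ s)))
          ≈⟨ total-crosses p s 0 (ℕ.≤-reflexive (≡.trans (ℕ.+-identityʳ _) (ℕ.+-suc p s))) ⟩
        iterate p (jump s) 0         ≡⟨ ≡.cong (λ m → iterate m (jump s) 0) (ℕ.+-identityʳ p) ⟨
        iterate (p ℕ.+ 0) (jump s) 0 ≈⟨ lagrange p 0 (jump s) ⟨
        (jump s ∘ M) p               ∎

-- Eliminating Y′ from the two equations for Y

module GregoryIdentity {c ℓ} (A : CommutativeRing c ℓ) where
  open CommutativeRing A
  open RawSemiringDefinitions (RawRing.rawSemiring rawRing) using (_^_)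
  open RingProperties ring using (-‿+-comm; -‿distribˡ-*)
  open SemiringSolver commutativeSemiring using (solve; _:+_; _:*_; con; _:=_)
  open SetoidReasoning setoid

  -- `gx` and `gy` stand for γ(M(x)) and γ(M(y)). Each of mx and my multiplies the equation for Y
  -- that contains the other, so the terms in Y′ coincide and cancel; x gx = mx and y gy = my turn
  -- the rest into squares.
  gregory-identity : ∀ {x y mx my gx gy Y Y′ G} → mx ≈ x * gx → my ≈ y * gy →
    Y ≈ gy + mx * Y′ → Y ≈ gx + my * Y′ →
    (- mx + my) * G ≈ y * mx ^ 2 + - (x * my ^ 2) →
    (- mx + my) * (G + x * (y * Y)) ≈ 0#
  gregory-identity {x} {y} {mx} {my} {gx} {gy} {Y} {Y′} {G} mx≈ my≈ Y≈₁ Y≈₂ G-eq = begin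
    (- mx + my) * (G + x * (y * Y))
      ≈⟨ trans (distribˡ _ _ _) (+-cong G-eq (trans (distribʳ _ _ _) (+-congʳ (sym (-‿distribˡ-* mx _))))) ⟩
    (P + - Q) + (- (mx * (x * (y * Y))) + my * (x * (y * Y)))
      ≈⟨ +-congˡ (+-cong (-‿cong mx-part) my-part) ⟩
    (P + - Q) + (- (P + Z) + (Q + Z))
      ≈⟨ +-congˡ (+-congʳ (sym (-‿+-comm P Z))) ⟩
    (P + - Q) + ((- P + - Z) + (Q + Z))
      -- The solver works in semirings, so the negatives enter as separate variables.
      ≈⟨ solve 6 (λ p q z p′ q′ z′ → (p :+ q′) :+ ((p′ :+ z′) :+ (q :+ z)) := (p :+ p′) :+ ((q :+ q′) :+ (z :+ z′)))
           refl P Q Z (- P) (- Q) (- Z) ⟩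
    (P + - P) + ((Q + - Q) + (Z + - Z))
      ≈⟨ +-cong (-‿inverseʳ P) (+-cong (-‿inverseʳ Q) (-‿inverseʳ Z)) ⟩
    0# + (0# + 0#)
      ≈⟨ trans (+-identityˡ _) (+-identityˡ _) ⟩
    0#  ∎
    where
    P = y * mx ^ 2
    Q = x * my ^ 2
    Z = x * (y * (mx * (my * Y′)))
    mx-part : mx * (x * (y * Y)) ≈ P + Z
    mx-part = begin
      mx * (x * (y * Y))                ≈⟨ *-congˡ (*-congˡ (*-congˡ Y≈₂)) ⟩
      mx * (x * (y * (gx + my * Y′)))
        ≈⟨ solve 6 (λ x y mx my gx Y′ → mx :* (x :* (y :* (gx :+ my :* Y′))) :=
                      y :* (mx :* ((x :* gx) :* con 1)) :+ x :* (y :* (mx :* (my :* Y′)))) refl x y mx my gx Y′ ⟩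
      y * (mx * ((x * gx) * 1#)) + Z
        ≈⟨ +-congʳ (*-congˡ (*-congˡ (*-congʳ (sym mx≈)))) ⟩
      P + Z  ∎
    my-part : my * (x * (y * Y)) ≈ Q + Z
    my-part = begin
      my * (x * (y * Y))                ≈⟨ *-congˡ (*-congˡ (*-congˡ Y≈₁)) ⟩
      my * (x * (y * (gy + mx * Y′)))
        ≈⟨ solve 6 (λ x y mx my gy Y′ → my :* (x :* (y :* (gy :+ mx :* Y′))) :=
                      x :* (my :* ((y :* gy) :* con 1)) :+ x :* (y :* (mx :* (my :* Y′)))) refl x y mx my gy Y′ ⟩
      x * (my * ((y * gy) * 1#)) + Z
        ≈⟨ +-congʳ (*-congˡ (*-congˡ (*-congʳ (sym my≈)))) ⟩
      Q + Z  ∎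

-- Series in two variables and the generating function Y

module Bivariate {c ℓ} (R : CommutativeRing c ℓ) where
  open CommutativeRing R
  open SeriesRing R
  open Composition R
  open Sums R
  open Walks R
  open PowerSeries rawRing using (_∘_)
  open RawSemiringDefinitions (RawRing.rawSemiring S.rawRing) using () renaming (_^_ to _⊛^_)
  open SetoidReasoning setoid
  private
    module Series₂ = SeriesRing seriesRing
    module C₂ = Composition seriesRing
    module ∑₂ = Sums seriesRing
    module T = C₂.S
  open PowerSeries S.rawRing using () renaming (_∘_ to _∘₂_; Series to Series₂)
  open RawSemiringDefinitions (RawRing.rawSemiring T.rawRing) using () renaming (_^_ to _⊛₂^_)
  open GregoryIdentity Series₂.seriesRing

  -- Over ℚ[a] this and the next three unfold to the embeddings and variables used to define the
  -- Gregory series.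
  inX : Series → Series₂
  inX f m = constant (f m)

  inY : Series → Series₂
  inY = Series₂.constant

  x y : Series₂
  x = inX X
  y = inY X

  constant-0 : constant 0# S.≈ S.0#
  constant-0 zero    = refl
  constant-0 (suc n) = refl

  constant-+ : ∀ a b → constant (a + b) S.≈ constant a S.+ constant b
  constant-+ a b zero    = refl
  constant-+ a b (suc n) = sym (+-identityˡ _)

  constant-*-homo : ∀ a b → constant (a * b) S.≈ constant a S.* constant b
  constant-*-homo a b = S.trans lemma (S.sym (constant-* a (constant b)))
    where
    lemma : constant (a * b) S.≈ scale a (constant b)
    lemma zero    = refl
    lemma (suc n) = sym (zeroʳ _)

  constant-∑ : ∀ n f → constant (∑ n f) S.≈ ∑₂.∑ n (λ k → constant (f k))
  constant-∑ zero    f = constant-0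
  constant-∑ (suc n) f = S.trans (constant-+ _ _) (S.+-congˡ {constant (f 0)} (constant-∑ n (λ k → f (suc k))))

  inX-* : ∀ f g → inX (f S.* g) T.≈ inX f T.* inX g
  inX-* f g zero    = S.trans (constant-+ (f 0 * g 0) 0#) (S.+-cong (constant-*-homo (f 0) (g 0)) constant-0)
  inX-* f g (suc n) = S.trans (constant-+ (f 0 * g (suc n)) ((tail f S.* g) n))
    (S.+-cong (constant-*-homo (f 0) (g (suc n))) (inX-* (tail f) g n))

  inX-1 : inX S.1# T.≈ T.1#
  inX-1 zero    = S.refl
  inX-1 (suc n) = constant-0

  inX-^ : ∀ f k → inX (f ⊛^ k) T.≈ (inX f ⊛₂^ k)
  inX-^ f zero    = inX-1
  inX-^ f (suc k) = T.trans (inX-* f (f ⊛^ k)) (T.*-congˡ {inX f} (inX-^ f k))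

  inX-∘ : ∀ f g → inX (f ∘ g) T.≈ inX f ∘₂ inX g
  inX-∘ f g n = S.trans (constant-∑ (suc n) (λ k → f k * (g ⊛^ k) n))
    (∑₂.∑-cong (suc n) (λ k → constant (f k * (g ⊛^ k) n)) (λ k → constant (f k) S.* (inX g ⊛₂^ k) n)
      (λ {k} _ → S.trans (constant-*-homo (f k) ((g ⊛^ k) n)) (S.*-congˡ {constant (f k)} (inX-^ g k n))))

  inY-* : ∀ f g → inY (f S.* g) T.≈ inY f T.* inY g
  inY-* f g = T.trans lemma (T.sym (Series₂.constant-* f (inY g)))
    where
    lemma : inY (f S.* g) T.≈ Series₂.scale f (inY g)
    lemma zero    = S.refl
    lemma (suc n) = S.sym (S.zeroʳ f)

  x≈X : x T.≈ Series₂.X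
  x≈X zero          = constant-0
  x≈X (suc zero)    = S.refl
  x≈X (suc (suc n)) = constant-0

  xy*-suc : ∀ F m n → (x T.* (y T.* F)) (suc m) (suc n) ≈ F m n
  xy*-suc F m n = begin
    (x T.* (y T.* F)) (suc m) (suc n)          ≈⟨ T.*-congʳ {y T.* F} x≈X (suc m) (suc n) ⟩
    (Series₂.X T.* (y T.* F)) (suc m) (suc n)  ≈⟨ C₂.X*-suc (y T.* F) m (suc n) ⟩
    (y T.* F) m (suc n)                        ≈⟨ Series₂.constant-* X F m (suc n) ⟩
    (X S.* F m) (suc n)                        ≈⟨ X*-suc (F m) n ⟩
    F m n                                      ∎

  ∑-coefficient : ∀ N (F : ℕ → Series) n → ∑₂.∑ N F n ≈ ∑ N (λ k → F k n)
  ∑-coefficient zero    F n = refl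
  ∑-coefficient (suc N) F n = +-congˡ (∑-coefficient N (λ k → F (suc k)) n)

  module _ (γ : Series) {M : Series} (M₀≈0 : M 0 ≈ 0#) (M≈Xγ[M] : M S.≈ X S.* (γ ∘ M)) where
    -- γ_k(M(y)) as the k-th coefficient of a series in an outer variable; substituting M(x) for
    -- that variable gives Y.
    τ : Series₂
    τ k = drop k γ ∘ M

    Y Y′ : Series₂
    Y  = τ ∘₂ inX M
    Y′ = Series₂.tail τ ∘₂ inX M

    private
      inX-M₀≈0 : inX M 0 S.≈ S.0#
      inX-M₀≈0 = S.trans (constant-cong M₀≈0) constant-0

    -- γ_k = γ k + t γ_(k+1), evaluated at M(y).
    τ-unfold : τ T.≈ inX γ T.+ Series₂.scale M (Series₂.tail τ)
    τ-unfold k = S.trans (∘-unfold M₀≈0 (drop k γ)) (S.+-cong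
      (constant-cong (reflexive (≡.cong γ (ℕ.+-identityʳ k))))
      (S.*-congˡ {M} (∘-congʳ {tail (drop k γ)} {drop (suc k) γ} M λ n → reflexive (≡.cong γ (ℕ.+-suc k n)))))

    -- Splits off the term k = 0.
    Y-unfoldX : Y T.≈ inY (γ ∘ M) T.+ inX M T.* Y′
    Y-unfoldX = C₂.∘-unfold {inX M} inX-M₀≈0 τ

    -- Splits off the first term of every γ_k; these terms add up to γ(M(x)).
    Y-unfoldY : Y T.≈ inX (γ ∘ M) T.+ inY M T.* Y′
    Y-unfoldY = T.trans (C₂.∘-congʳ (inX M) τ-unfold)
      (T.trans (C₂.∘-+ (inX γ) (Series₂.scale M (Series₂.tail τ)) (inX M))
      (T.+-cong (T.sym (inX-∘ γ M))
        (T.trans (C₂.∘-scale M (Series₂.tail τ) (inX M)) (T.sym (Series₂.constant-* M Y′)))))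

    -- Powers of M(x) are constant in y, so the coefficient of y^(s+1) can be taken inside the sum
    -- over k.
    Y-coefficient : ∀ p s → Y p (suc s) ≈ (jump γ M₀≈0 M≈Xγ[M] s ∘ M) p
    Y-coefficient p s = trans (∑-coefficient (suc p) (λ k → τ k S.* (inX M ⊛₂^ k) p) (suc s))
      (∑-cong (suc p) (λ k → (τ k S.* (inX M ⊛₂^ k) p) (suc s)) (λ k → τ k (suc s) * (M ⊛^ k) p) λ {k} _ →
        begin
        (τ k S.* (inX M ⊛₂^ k) p) (suc s)       ≈⟨ S.*-congˡ {τ k} (T.sym (inX-^ M k) p) (suc s) ⟩
        (τ k S.* constant ((M ⊛^ k) p)) (suc s) ≈⟨ S.*-comm (τ k) (constant ((M ⊛^ k) p)) (suc s) ⟩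
        (constant ((M ⊛^ k) p) S.* τ k) (suc s) ≈⟨ constant-* ((M ⊛^ k) p) (τ k) (suc s) ⟩
        (M ⊛^ k) p * τ k (suc s)                ≈⟨ *-comm _ _ ⟩
        τ k (suc s) * (M ⊛^ k) p                ∎)

    inX-M≈ : inX M T.≈ x T.* inX (γ ∘ M)
    inX-M≈ = T.trans (λ n → constant-cong (M≈Xγ[M] n)) (inX-* X (γ ∘ M))

    inY-M≈ : inY M T.≈ y T.* inY (γ ∘ M)
    inY-M≈ = T.trans (C₂.constant-cong M≈Xγ[M]) (inY-* X (γ ∘ M))

    module _ (γ₀-regular : Regular (γ 0)) where

      -- M = t γ(M), and both factors are regular, the second by its constant term γ 0.
      M-regular : SRegular M
      M-regular {g} Mg≈0 = regular-head⇒regular {γ ∘ M}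
        (λ γ₀y≈0 → γ₀-regular (trans (*-congʳ (sym (trans (+-identityʳ _) (*-identityʳ _)))) γ₀y≈0))
        (X-regular (S.trans (S.sym (S.*-assoc X (γ ∘ M) g)) (S.trans (S.*-congʳ {g} (S.sym M≈Xγ[M])) Mg≈0)))

      -- As a series in x, the difference has constant term M(y), because M has zero constant term.
      difference-regular : C₂.SRegular (T.- inX M T.+ inY M)
      difference-regular = C₂.regular-head⇒regular {T.- inX M T.+ inY M} λ {g} Δ₀g≈0 → M-regular {g}
        (S.trans (S.*-congʳ {g} (S.sym Δ₀≈M)) Δ₀g≈0)
        where
        Δ₀≈M : S.- constant (M 0) S.+ M S.≈ M
        Δ₀≈M = S.trans (S.+-congʳ {M} (S.trans (S.-‿cong inX-M₀≈0) (RingProperties.-0#≈0# S.ring))) (S.+-identityˡ M)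

      gregory+xyY≈0 : ∀ G → (T.- inX M T.+ inY M) T.* G T.≈ y T.* (inX M ⊛₂^ 2) T.+ T.- (x T.* (inY M ⊛₂^ 2)) →
                      G T.+ x T.* (y T.* Y) T.≈ T.0#
      gregory+xyY≈0 G G-eq = difference-regular
        (gregory-identity {x} {y} {inX M} {inY M} {inX (γ ∘ M)} {inY (γ ∘ M)} {Y} {Y′} {G}
          inX-M≈ inY-M≈ Y-unfoldX Y-unfoldY G-eq)

    -- With γ 0 = -1, the factor γ 0 in `total-S` becomes a sign and γ 0 is regular. Multiplying Y
    -- by xy shifts both indices by one.
    gregory-coefficient : γ 0 ≈ - 1# → ∀ G →
      (T.- inX M T.+ inY M) T.* G T.≈ y T.* (inX M ⊛₂^ 2) T.+ T.- (x T.* (inY M ⊛₂^ 2)) →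
      ∀ p s → foldr _+_ 0# (map (weight γ) (S (suc p) (suc (p ℕ.+ s)))) ≈ G (suc p) (suc (suc s))
    gregory-coefficient γ₀≈-1 G G-eq p s = begin
      total-weight                  ≈⟨ -‿involutive total-weight ⟨
      - - total-weight              ≈⟨ -‿cong -total≈Y ⟩
      - Y p (suc s)                 ≈⟨ +-inverseˡ-unique (G (suc p) (suc (suc s))) (Y p (suc s)) G+Y≈0 ⟨
      G (suc p) (suc (suc s))       ∎
      where
      open RingProperties ring using (-‿involutive; -1*x≈-x; +-inverseˡ-unique; -0#≈0#)
      total-weight = foldr _+_ 0# (map (weight γ) (S (suc p) (suc (p ℕ.+ s))))
      -total≈Y : - total-weight ≈ Y p (suc s)
      -total≈Y = begin
        - total-weight         ≈⟨ -1*x≈-x total-weight ⟨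
        - 1# * total-weight    ≈⟨ *-congʳ γ₀≈-1 ⟨
        γ 0 * total-weight     ≈⟨ total-S γ M₀≈0 M≈Xγ[M] p s ⟩
        _                      ≈⟨ Y-coefficient p s ⟨
        Y p (suc s)            ∎
      γ₀-regular : Regular (γ 0)
      γ₀-regular {z} γ₀z≈0 = begin
        z        ≈⟨ -‿involutive z ⟨
        - - z    ≈⟨ -‿cong (trans (sym (-1*x≈-x z)) (trans (*-congʳ (sym γ₀≈-1)) γ₀z≈0)) ⟩
        - 0#     ≈⟨ -0#≈0# ⟩
        0#       ∎
      G+Y≈0 : G (suc p) (suc (suc s)) + Y p (suc s) ≈ 0#
      G+Y≈0 = trans (+-congˡ (sym (xy*-suc Y p (suc s)))) (gregory+xyY≈0 γ₀-regular G G-eq (suc p) (suc (suc s)))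

-- The substitution of -t for t

module Negation {c ℓ} (R : CommutativeRing c ℓ) where
  open CommutativeRing R
  open SeriesRing R
  open Composition R
  open Sums R
  open Walks R using (weight)
  open PowerSeries rawRing using (_∘_; atNegative)
  open RawSemiringDefinitions (RawRing.rawSemiring rawRing) using (_^_)
  open RawSemiringDefinitions (RawRing.rawSemiring S.rawRing) using () renaming (_^_ to _⊛^_)
  open SemiringSolver commutativeSemiring using (solve; _:+_; _:*_; con; _:=_)
  open SetoidReasoning setoid

  atNegative-cong : ∀ {f g} → f S.≈ g → atNegative f S.≈ atNegative g
  atNegative-cong f≈g n = *-congˡ (f≈g n)

  tail-atNegative : ∀ f → tail (atNegative f) S.≈ scale (- 1#) (atNegative (tail f))
  tail-atNegative f n = *-assoc _ _ _

  atNegative-* : ∀ f g → atNegative (f S.* g) S.≈ atNegative f S.* atNegative g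
  atNegative-* f g zero    = solve 2 (λ x y → con 1 :* (x :* y :+ con 0) := con 1 :* x :* (con 1 :* y) :+ con 0) refl (f 0) (g 0)
  atNegative-* f g (suc n) = begin
    ((- 1#) * (- 1#) ^ n) * (f 0 * g (suc n) + (tail f S.* g) n)
      ≈⟨ solve 5 (λ m s x y u → m :* s :* (x :* y :+ u) := con 1 :* x :* (m :* s :* y) :+ m :* (s :* u)) refl
           (- 1#) ((- 1#) ^ n) (f 0) (g (suc n)) ((tail f S.* g) n) ⟩
    1# * f 0 * atNegative g (suc n) + (- 1#) * atNegative (tail f S.* g) n
      ≈⟨ +-congˡ (*-congˡ (atNegative-* (tail f) g n)) ⟩
    1# * f 0 * atNegative g (suc n) + (- 1#) * (atNegative (tail f) S.* atNegative g) n
      ≈⟨ +-congˡ (scale-* (- 1#) (atNegative (tail f)) (atNegative g) n) ⟨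
    1# * f 0 * atNegative g (suc n) + (scale (- 1#) (atNegative (tail f)) S.* atNegative g) n
      ≈⟨ +-congˡ (S.*-congʳ {atNegative g} (S.sym (tail-atNegative f)) n) ⟩
    (atNegative f S.* atNegative g) (suc n)  ∎

  atNegative-1 : atNegative S.1# S.≈ S.1#
  atNegative-1 zero    = *-identityˡ _
  atNegative-1 (suc n) = zeroʳ _

  atNegative-^ : ∀ f k → atNegative (f ⊛^ k) S.≈ (atNegative f ⊛^ k)
  atNegative-^ f zero    = atNegative-1
  atNegative-^ f (suc k) = S.trans (atNegative-* f (f ⊛^ k)) (S.*-congˡ {atNegative f} (atNegative-^ f k))

  atNegative-∘ : ∀ f g → atNegative (f ∘ g) S.≈ f ∘ atNegative g
  atNegative-∘ f g n = trans (*-distribˡ-∑ (suc n) ((- 1#) ^ n) (λ k → f k * (g ⊛^ k) n))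
    (∑-cong (suc n) (λ k → (- 1#) ^ n * (f k * (g ⊛^ k) n)) (λ k → f k * (atNegative g ⊛^ k) n) λ {k} _ → begin
      (- 1#) ^ n * (f k * (g ⊛^ k) n)
        ≈⟨ solve 3 (λ s x y → s :* (x :* y) := x :* (s :* y)) refl ((- 1#) ^ n) (f k) ((g ⊛^ k) n) ⟩
      f k * atNegative (g ⊛^ k) n     ≈⟨ *-congˡ (atNegative-^ g k n) ⟩
      f k * (atNegative g ⊛^ k) n     ∎)

  atNegative-X : atNegative X S.≈ scale (- 1#) X
  atNegative-X zero          = trans (zeroʳ _) (sym (zeroʳ _))
  atNegative-X (suc zero)    = *-congʳ (*-identityʳ _)
  atNegative-X (suc (suc n)) = trans (zeroʳ _) (sym (zeroʳ _))

  -- Replacing t by -t negates the factor `X`, and the sign moves into the outer series: L = t β(L)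
  -- becomes M = t γ(M) with γ = -β.
  atNegative-fixedPoint : ∀ {f g} → g S.≈ X S.* (f ∘ g) → atNegative g S.≈ X S.* (scale (- 1#) f ∘ atNegative g)
  atNegative-fixedPoint {f} {g} g≈ = S.trans (atNegative-cong g≈) (S.trans (atNegative-* X (f ∘ g))
    (S.trans (S.*-cong {atNegative X} {scale (- 1#) X} {atNegative (f ∘ g)} {f ∘ atNegative g} atNegative-X (atNegative-∘ f g))
    (S.trans (scale-* (- 1#) X (f ∘ atNegative g))
    (S.trans (S.sym (scale-*ʳ (- 1#) X (f ∘ atNegative g)))
      (S.*-congˡ {X} (S.sym (∘-scale (- 1#) f (atNegative g))))))))

  -- One factor z for each entry; for z = -1 this is the sign (-1)^r in `C`.
  weight-scale : ∀ z f {k} (ns : Vec ℕ k) → weight (scale z f) ns ≈ z ^ k * weight f ns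
  weight-scale z f []       = sym (*-identityˡ _)
  weight-scale z f {suc k} (n ∷ ns) = trans (*-congˡ (weight-scale z f ns))
    (solve 4 (λ z x zk w → z :* x :* (zk :* w) := z :* zk :* (x :* w)) refl z (f n) (z ^ k) (weight f ns))

  weights-scale : ∀ z f {k} (nss : List (Vec ℕ k)) →
    foldr _+_ 0# (map (weight (scale z f)) nss) ≈ z ^ k * foldr _+_ 0# (map (weight f) nss)
  weights-scale z f []         = sym (zeroʳ _)
  weights-scale z f (ns ∷ nss) = trans (+-cong (weight-scale z f ns) (weights-scale z f nss)) (sym (distribˡ _ _ _))

-- Exponential series and the fixed-point equation for L

module Exponential {c ℓ} (R : CommutativeRing c ℓ) where
  open CommutativeRing R
  open SeriesRing R
  open Composition R
  open PowerSeries rawRing using (_∘_)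
  open RawSemiringDefinitions (RawRing.rawSemiring rawRing) using (_^_) renaming (_×_ to _·_)
  open Mult semiring using (×-congʳ; ×-assocˡ; ×-comm-*; ×-assoc-*)
  open CommutativeMonoidMult +-commutativeMonoid using (×-distrib-+)
  open SemiringSolver commutativeSemiring using (solve; _:+_; _:*_; con; _:=_)
  open SetoidReasoning setoid

  -- The Euler operator t d/dt.
  θ : Series → Series
  θ f n = n · f n

  θ-* : ∀ f g → θ (f S.* g) S.≈ θ f S.* g S.+ f S.* θ g
  θ-* f g zero    = solve 2 (λ x y → con 0 := (con 0 :* y :+ con 0) :+ (x :* con 0 :+ con 0)) refl (f 0) (g 0)
  θ-* f g (suc n) = begin
    suc n · (f 0 * g (suc n) + (tail f S.* g) n)
      ≈⟨ ×-distrib-+ _ _ (suc n) ⟩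
    suc n · (f 0 * g (suc n)) + ((tail f S.* g) n + n · (tail f S.* g) n)
      ≈⟨ +-cong (sym (×-comm-* (suc n) (f 0) (g (suc n)))) (+-congˡ (θ-* (tail f) g n)) ⟩
    f 0 * θ g (suc n) + ((tail f S.* g) n + ((θ (tail f) S.* g) n + (tail f S.* θ g) n))
      ≈⟨ solve 5 (λ z x a b c → x :+ (a :+ (b :+ c)) := (con 0 :* z :+ (a :+ b)) :+ (x :+ c)) refl
           (g (suc n)) (f 0 * θ g (suc n)) ((tail f S.* g) n) ((θ (tail f) S.* g) n) ((tail f S.* θ g) n) ⟩
    (0# * g (suc n) + ((tail f S.* g) n + (θ (tail f) S.* g) n)) + (f S.* θ g) (suc n)
      ≈⟨ +-congʳ (+-congˡ (S.distribʳ g (tail f) (θ (tail f)) n)) ⟨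
    (θ f S.* g) (suc n) + (f S.* θ g) (suc n)  ∎

  -- e n plays the role of 1/n!.
  module _ (e : ℕ → Carrier) (e₀≈1 : e 0 ≈ 1#) (e-suc : ∀ n → suc n · e (suc n) ≈ e n)
           (exp : Carrier → Series) (exp≈ : ∀ u n → exp u n ≈ e n * u ^ n) where

    n!·e≈1 : ∀ n → (n !) · e n ≈ 1#
    n!·e≈1 zero    = trans (+-identityʳ _) e₀≈1
    n!·e≈1 (suc n) = begin
      (suc n ℕ.* n !) · e (suc n)    ≡⟨ ≡.cong (_· e (suc n)) (ℕ.*-comm (suc n) (n !)) ⟩
      (n ! ℕ.* suc n) · e (suc n)    ≈⟨ ×-assocˡ (e (suc n)) (n !) (suc n) ⟨
      (n !) · (suc n · e (suc n))    ≈⟨ ×-congʳ (n !) (e-suc n) ⟩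
      (n !) · e n                    ≈⟨ n!·e≈1 n ⟩
      1#                             ∎

    ×-zero : ∀ n → n · 0# ≈ 0#
    ×-zero zero    = refl
    ×-zero (suc n) = trans (+-identityˡ _) (×-zero n)

    -- (n + 1)! is invertible, and n + 1 divides it.
    ×-torsionFree : ∀ n {z} → suc n · z ≈ 0# → z ≈ 0#
    ×-torsionFree n {z} nz≈0 = begin
      z                              ≈⟨ *-identityˡ z ⟨
      1# * z                         ≈⟨ *-congʳ (n!·e≈1 (suc n)) ⟨
      ((suc n !) · e (suc n)) * z    ≈⟨ ×-assoc-* (suc n !) (e (suc n)) z ⟩
      (suc n !) · (e (suc n) * z)    ≈⟨ ×-comm-* (suc n !) (e (suc n)) z ⟨
      e (suc n) * ((suc n ℕ.* n !) · z)
        ≡⟨ ≡.cong (λ m → e (suc n) * (m · z)) (ℕ.*-comm (suc n) (n !)) ⟩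
      e (suc n) * ((n ! ℕ.* suc n) · z)  ≈⟨ *-congˡ (×-assocˡ z (n !) (suc n)) ⟨
      e (suc n) * ((n !) · (suc n · z))  ≈⟨ *-congˡ (trans (×-congʳ (n !) nz≈0) (×-zero (n !))) ⟩
      e (suc n) * 0#                 ≈⟨ zeroʳ _ ⟩
      0#                             ∎

    exp₀≈1 : ∀ u → exp u 0 ≈ 1#
    exp₀≈1 u = trans (exp≈ u 0) (trans (*-identityʳ _) e₀≈1)

    -- The differential equation of e^(ut), multiplied by t.
    θ-exp : ∀ u → θ (exp u) S.≈ scale u (X S.* exp u)
    θ-exp u zero    = sym (trans (*-congˡ (X*-zero (exp u))) (zeroʳ u))
    θ-exp u (suc n) = begin
      suc n · exp u (suc n)               ≈⟨ ×-congʳ (suc n) (exp≈ u (suc n)) ⟩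
      suc n · (e (suc n) * (u * u ^ n))   ≈⟨ ×-assoc-* (suc n) (e (suc n)) (u * u ^ n) ⟨
      (suc n · e (suc n)) * (u * u ^ n)   ≈⟨ *-congʳ (e-suc n) ⟩
      e n * (u * u ^ n)                   ≈⟨ solve 3 (λ x y z → x :* (y :* z) := y :* (x :* z)) refl (e n) u (u ^ n) ⟩
      u * (e n * u ^ n)                   ≈⟨ *-congˡ (exp≈ u n) ⟨
      u * exp u n                         ≈⟨ *-congˡ (X*-suc (exp u) n) ⟨
      u * (X S.* exp u) (suc n)           ∎

    -- By the product rule `θ` annihilates the product, so n + 1 times its coefficient in degree n +
    -- 1 is zero, and there is no torsion.
    exp-neg-* : ∀ u → exp (- u) S.* exp u S.≈ S.1#
    exp-neg-* u zero    = trans (+-identityʳ _) (trans (*-cong (exp₀≈1 (- u)) (exp₀≈1 u)) (*-identityˡ _))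
    exp-neg-* u (suc n) = ×-torsionFree n (begin
      θ (exp (- u) S.* exp u) (suc n)
        ≈⟨ θ-* (exp (- u)) (exp u) (suc n) ⟩
      (θ (exp (- u)) S.* exp u) (suc n) + (exp (- u) S.* θ (exp u)) (suc n)
        ≈⟨ +-cong
             (S.trans (S.*-congʳ {exp u} (θ-exp (- u))) (S.trans (scale-* (- u) (X S.* exp (- u)) (exp u))
               (λ n → *-congˡ (S.*-assoc X (exp (- u)) (exp u) n))) (suc n))
             (S.trans (S.*-congˡ {exp (- u)} (θ-exp u)) (S.trans (scale-*ʳ u (exp (- u)) (X S.* exp u))
               (λ n → *-congˡ (swap n))) (suc n)) ⟩
      (- u) * P + u * P    ≈⟨ distribʳ _ _ _ ⟨
      (- u + u) * P        ≈⟨ trans (*-congʳ (-‿inverseˡ u)) (zeroˡ _) ⟩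
      0#                   ∎)
      where
      P = (X S.* (exp (- u) S.* exp u)) (suc n)
      swap : exp (- u) S.* (X S.* exp u) S.≈ X S.* (exp (- u) S.* exp u)
      swap = S.trans (S.sym (S.*-assoc (exp (- u)) X (exp u)))
        (S.trans (S.*-congʳ {exp u} (S.*-comm (exp (- u)) X)) (S.*-assoc X (exp (- u)) (exp u)))

    module _ {b : Series} {a : Carrier} (b-eq : (exp 1# S.+ S.- S.1#) S.* b S.≈ X S.* exp a) where

      -- Compares degree 1 in the Bernoulli equation, where e^t - 1 = t + ⋯.
      b₀≈1 : b 0 ≈ 1#
      b₀≈1 = begin
        b 0                         ≈⟨ *-identityˡ _ ⟨
        1# * b 0                    ≈⟨ *-congʳ (trans (e-suc 0) e₀≈1) ⟨
        (e 1 + 0#) * b 0            ≈⟨ *-congʳ (+-cong (trans (exp≈ 1# 1) (trans (*-congˡ (*-identityˡ 1#)) (*-identityʳ (e 1)))) (-0#≈0#)) ⟨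
        (exp 1# 1 + - 0#) * b 0
          ≈⟨ trans (+-congʳ (trans (*-congʳ (trans (+-congʳ (exp₀≈1 1#)) (-‿inverseʳ 1#))) (zeroˡ _)))
               (trans (+-identityˡ _) (+-identityʳ _)) ⟨
        ((exp 1# S.+ S.- S.1#) S.* b) 1  ≈⟨ b-eq 1 ⟩
        (X S.* exp a) 1             ≈⟨ X*-suc (exp a) 0 ⟩
        exp a 0                     ≈⟨ exp₀≈1 a ⟩
        1#                          ∎
        where open RingProperties ring using (-0#≈0#)

      E : Series
      E = exp (- a) S.* (exp 1# S.+ S.- S.1#)

      -- The factor e^(-at) of E cancels e^(at) in the Bernoulli equation.
      E*b≈X : E S.* b S.≈ X
      E*b≈X = S.trans (S.*-assoc (exp (- a)) (exp 1# S.+ S.- S.1#) b)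
        (S.trans (S.*-congˡ {exp (- a)} b-eq)
        (S.trans (S.*-comm (exp (- a)) (X S.* exp a))
        (S.trans (S.*-assoc X (exp a) (exp (- a)))
        (S.trans (S.*-congˡ {X} (S.trans (S.*-comm (exp a) (exp (- a))) (exp-neg-* a)))
          (S.*-identityʳ X)))))

      -- Substituting L into E b = t gives E(L) b(L) = L, where E(L) = t.
      inverse-fixedPoint : ∀ {L} → L 0 ≈ 0# → E ∘ L S.≈ X → L S.≈ X S.* (b ∘ L)
      inverse-fixedPoint {L} L₀≈0 E∘L≈X = S.trans (S.sym (X∘ L₀≈0))
        (S.trans (∘-congʳ L (S.sym E*b≈X)) (S.trans (∘-* L₀≈0 E b) (S.*-congʳ {b ∘ L} E∘L≈X)))

-- The formula over a ring with inverse factorials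

module GeneralizedGregory {c ℓ} (R : CommutativeRing c ℓ) where
  open CommutativeRing R
  open SeriesRing R
  open Composition R
  open Bivariate R
  open Negation R
  open Exponential R
  open Walks R using (weight)
  open PowerSeries rawRing using (_∘_; atNegative)
  open RawSemiringDefinitions (RawRing.rawSemiring rawRing) using (_^_) renaming (_×_ to _·_)
  private
    module T = RawRing (PowerSeries.rawRing S.rawRing)
  open RawSemiringDefinitions T.rawSemiring using () renaming (_^_ to _⊛₂^_)

  module _ (e : ℕ → Carrier) (e₀≈1 : e 0 ≈ 1#) (e-suc : ∀ n → suc n · e (suc n) ≈ e n)
           (exp : Carrier → Series) (exp≈ : ∀ u n → exp u n ≈ e n * u ^ n)
           {b L : Series} {a : Carrier}
           (b-eq : (exp 1# S.+ S.- S.1#) S.* b S.≈ X S.* exp a)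
           (L₀≈0 : L 0 ≈ 0#) (E∘L≈X : (exp (- a) S.* (exp 1# S.+ S.- S.1#)) ∘ L S.≈ X) where

    gregory-formula : ∀ G → let M = atNegative L in
      (T.- inX M T.+ inY M) T.* G T.≈ y T.* (inX M ⊛₂^ 2) T.+ T.- (x T.* (inY M ⊛₂^ 2)) →
      ∀ p s → let r = suc (p ℕ.+ s) in
      (- 1#) ^ r * foldr _+_ 0# (map (weight b) (S (suc p) r)) ≈ G (suc p) (suc (suc s))
    gregory-formula G G-eq p s = trans
      (sym (weights-scale (- 1#) b (S (suc p) (suc (p ℕ.+ s)))))
      (gregory-coefficient (scale (- 1#) b)
        -- The constant term of L(-t) unfolds to `1# * L 0`.
        (trans (*-identityˡ (L 0)) L₀≈0)
        (atNegative-fixedPoint {b} {L} (inverse-fixedPoint e e₀≈1 e-suc exp exp≈ b-eq L₀≈0 E∘L≈X))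
        (trans (*-congˡ (b₀≈1 e e₀≈1 e-suc exp exp≈ b-eq)) (*-identityʳ (- 1#)))
        G G-eq p s)

-- The polynomial ring

module PolynomialRing {c ℓ} (R : CommutativeRing c ℓ) where
  open CommutativeRing R
  open Polynomial rawRing using (coeff) renaming (scale to scaleᴾ; mul to mulᴾ; rawRing to polynomialRawRing)
  open SeriesRing R
  private
    module S = CommutativeRing seriesRing
    module P = RawRing polynomialRawRing
  open RingProperties ring using (-0#≈0#)

  coeff-+ : ∀ p q → coeff (p P.+ q) S.≈ coeff p S.+ coeff q
  coeff-+ []      q       n       = sym (+-identityˡ _)
  coeff-+ (z ∷ p) []      n       = sym (+-identityʳ _)
  coeff-+ (z ∷ p) (w ∷ q) zero    = refl
  coeff-+ (z ∷ p) (w ∷ q) (suc n) = coeff-+ p q n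

  coeff-neg : ∀ p → coeff (P.- p) S.≈ S.- coeff p
  coeff-neg []      n       = sym -0#≈0#
  coeff-neg (z ∷ p) zero    = refl
  coeff-neg (z ∷ p) (suc n) = coeff-neg p n

  coeff-scale : ∀ z p → coeff (scaleᴾ z p) S.≈ scale z (coeff p)
  coeff-scale z []      n       = sym (zeroʳ z)
  coeff-scale z (w ∷ p) zero    = refl
  coeff-scale z (w ∷ p) (suc n) = coeff-scale z p n

  coeff-* : ∀ p q → coeff (p P.* q) S.≈ coeff p S.* coeff q
  coeff-* []      q n       = sym (S.zeroˡ (coeff q) n)
  coeff-* (z ∷ p) q zero    = trans (coeff-+ (scaleᴾ z q) (0# ∷ mulᴾ p q) 0) (+-congʳ (coeff-scale z q 0))
  coeff-* (z ∷ p) q (suc n) = trans (coeff-+ (scaleᴾ z q) (0# ∷ mulᴾ p q) (suc n))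
    (+-cong (coeff-scale z q (suc n)) (coeff-* p q n))

  coeff-1 : coeff P.1# S.≈ S.1#
  coeff-1 zero    = refl
  coeff-1 (suc n) = refl

  -- Polynomials are equal when their coefficient series are, so injectivity is immediate and the
  -- ring laws are inherited from power series.
  coeff-isRingMonomorphism : IsRingMonomorphism polynomialRawRing S.rawRing coeff
  coeff-isRingMonomorphism = record
    { isRingHomomorphism = record
      { isSemiringHomomorphism = record
        { isNearSemiringHomomorphism = record
          { +-isMonoidHomomorphism = record
            { isMagmaHomomorphism = record
              { isRelHomomorphism = record { cong = λ p≈q → p≈q }
              ; homo = coeff-+
              }
            ; ε-homo = λ _ → refl
            }
          ; *-homo = coeff-*
          }
        ; 1#-homo = coeff-1
        }
      ; -‿homo = coeff-neg
      }
    ; injective = λ p≈q → p≈q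
    }

  polynomialRing : CommutativeRing c ℓ
  polynomialRing = record
    { isCommutativeRing = RingMonomorphism.isCommutativeRing coeff-isRingMonomorphism S.isCommutativeRing }

  -- Brings `(1/ n !) • (u ^ n)` into the form `e n * u ^ n`, with a constant polynomial as `e n`.
  scale≈constant-* : ∀ z p → scaleᴾ z p P.≈ (z ∷ []) P.* p
  scale≈constant-* z p n = sym (trans (coeff-+ (scaleᴾ z p) (0# ∷ []) n) (trans (+-congˡ (zeroPolynomial n)) (+-identityʳ _)))
    where
    zeroPolynomial : ∀ n → coeff (0# ∷ []) n ≈ 0#
    zeroPolynomial zero    = refl
    zeroPolynomial (suc n) = refl

-- The ring ℚ[a] and its inverse factorials

ℚ[a]-ring : CommutativeRing _ _
ℚ[a]-ring = PolynomialRing.polynomialRing ℚ.+-*-commutativeRing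

open RawSemiringDefinitions (RawRing.rawSemiring ℚ.+-*-rawRing) using () renaming (_×_ to _·ℚ_)
open RawSemiringDefinitions (RawRing.rawSemiring ℚ[a].rawRing) using () renaming (_×_ to _·_)

-- Fractions are compared in unnormalised form, where equality is cross-multiplication.
toℚᵘ-/ : ∀ n d .{{_ : ℕ.NonZero d}} → toℚᵘ (n ℚ./ d) ℚᵘ.≃ n ℚᵘ./ d
toℚᵘ-/ n (suc d) = ℚ.toℚᵘ-fromℚᵘ (ℚᵘ.mkℚᵘ n d)

·-1/ : ∀ n d .{{_ : ℕ.NonZero d}} → n ·ℚ (ℤ.+ 1 ℚ./ d) ≡ ℤ.+ n ℚ./ d
·-1/ zero    d = ≡.sym (ℚ.0/n≡0 d)
·-1/ (suc n) d@(suc _) = ≡.trans (≡.cong ((ℤ.+ 1 ℚ./ d) ℚ.+_) (·-1/ n d)) (ℚ.toℚᵘ-injective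
  (ℚᵘ.≃-trans (ℚ.toℚᵘ-homo-+ (ℤ.+ 1 ℚ./ d) (ℤ.+ n ℚ./ d))
  (ℚᵘ.≃-trans (ℚᵘ.+-cong (toℚᵘ-/ (ℤ.+ 1) d) (toℚᵘ-/ (ℤ.+ n) d))
  (ℚᵘ.≃-trans same-denominator (ℚᵘ.≃-sym (toℚᵘ-/ (ℤ.+ suc n) d))))))
  where
  same-denominator : (ℤ.+ 1 ℚᵘ./ d) ℚᵘ.+ (ℤ.+ n ℚᵘ./ d) ℚᵘ.≃ ℤ.+ suc n ℚᵘ./ d
  same-denominator = ℚᵘ.*≡* (≡.trans
    (≡.cong (ℤ._* ℤ.+ d) (≡.sym (ℤ.*-distribʳ-+ (ℤ.+ d) (ℤ.+ 1) (ℤ.+ n))))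
    (ℤ.*-assoc (ℤ.+ suc n) (ℤ.+ d) (ℤ.+ d)))

suc·1/suc! : ∀ n → suc n ·ℚ (1/ suc n !) ≡ 1/ n !
suc·1/suc! n = ≡.trans (·-1/ (suc n) (suc n !) {{suc n ℕ.!≢0}}) (ℚ.toℚᵘ-injective
  (ℚᵘ.≃-trans (toℚᵘ-/ (ℤ.+ suc n) (suc n !) {{suc n ℕ.!≢0}})
  (ℚᵘ.≃-trans (cancel (n !) {{n ℕ.!≢0}} {{suc n ℕ.!≢0}}) (ℚᵘ.≃-sym (toℚᵘ-/ (ℤ.+ 1) (n !) {{n ℕ.!≢0}})))))
  where
  cancel : ∀ d .{{_ : ℕ.NonZero d}} .{{_ : ℕ.NonZero (suc n ℕ.* d)}} → ℤ.+ suc n ℚᵘ./ (suc n ℕ.* d) ℚᵘ.≃ ℤ.+ 1 ℚᵘ./ d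
  cancel (suc d) = ℚᵘ.*≡* (≡.trans (≡.sym (ℤ.pos-* (suc n) (suc d))) (≡.sym (ℤ.*-identityˡ _)))

1/!ᴾ : ℕ → ℚ[a].Carrier
1/!ᴾ n = (1/ n !) ∷ []

·-constant : ∀ n q → n · (q ∷ []) ℚ[a].≈ ((n ·ℚ q) ∷ [])
·-constant zero    q zero    = ≡.refl
·-constant zero    q (suc k) = ≡.refl
·-constant (suc n) q k = ≡.trans (coeff-+ (q ∷ []) (n · (q ∷ [])) k)
  (≡.trans (≡.cong (coeff (q ∷ []) k ℚ.+_) (·-constant n q k)) (lemma k))
  where
  open PolynomialRing ℚ.+-*-commutativeRing
  open ℚ[a] using (coeff)
  lemma : ∀ k → coeff (q ∷ []) k ℚ.+ coeff ((n ·ℚ q) ∷ []) k ≡ coeff ((suc n ·ℚ q) ∷ []) k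
  lemma zero    = ≡.refl
  lemma (suc k) = ≡.refl

1/!ᴾ-suc : ∀ n → suc n · 1/!ᴾ (suc n) ℚ[a].≈ 1/!ᴾ n
1/!ᴾ-suc n k = ≡.trans (·-constant (suc n) (1/ suc n !) k) (≡.cong (λ q → ℚ[a].coeff (q ∷ []) k) (suc·1/suc! n))

-- The identity in ℚ[a]

open import Data.Nat.Base using (_+_)

theorem6p4 : (B : ℕ → ℚ[a].Carrier) → IsBernoulli B →
    (L : ℚ[a]⟦t⟧.Series) → IsL L →
    (G : ℕ → ℕ → ℚ[a].Carrier) → IsGregory L G →
    ∀ (i r : ℕ) → 1 ≤ i → i ≤ r →
    C B i r ℚ[a].≈ G i (r ∸ i + 2)
-- With i = p + 1 and s = r - i, r is `suc (p + s)` and the second index is s + 2.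
theorem6p4 B B-eq L L-inverse G G-eq (suc p) r _ i≤r = ≡.subst
  (λ r → C B (suc p) r ℚ[a].≈ G (suc p) (r ∸ suc p + 2)) (ℕ.m+[n∸m]≡n i≤r) (coefficient (r ∸ suc p))
  where
  open PowerSeries.IsCompositionalInverse L-inverse
  exp≈ : ∀ u n → exp u n ℚ[a].≈ 1/!ᴾ n ℚ[a].* (u ℚ[a].^ n)
  exp≈ u n = PolynomialRing.scale≈constant-* ℚ.+-*-commutativeRing (1/ n !) (u ℚ[a].^ n)
  coefficient : ∀ s → C B (suc p) (suc (p + s)) ℚ[a].≈ G (suc p) (p + s ∸ p + 2)
  coefficient s = ≡.subst (λ n → C B (suc p) (suc (p + s)) ℚ[a].≈ G (suc p) n)
    (≡.sym (≡.trans (≡.cong (_+ 2) (ℕ.m+n∸m≡n p s)) (ℕ.+-comm s 2)))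
    -- In `IsL` the series L is the second one, `g`, of the inverse pair; 1/0! = 1 holds by
    -- computation.
    (GeneralizedGregory.gregory-formula ℚ[a]-ring 1/!ᴾ (λ _ → ≡.refl) 1/!ᴾ-suc exp exp≈
      {λ n → (1/ n !) ℚ[a].• B n} {L} {ℚ[a].a} B-eq g₀≈0 f∘g≈X G G-eq p s)
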